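{- For every constant $0<c\le 1/3$ we have, as $n\to\infty$, \[g(n;3,cn)\ge\frac{n^2}{2}\,(c-o(1)).\]
   Context: A red/blue/purple colouring of $K_n$ is a partition $R\cup B\cup P$ of its edge set. For integers $s,t\ge2$ and $n<R(s,t)$, $g(n;s,t)$ is the largest integer $g$ such that some red/blue/purple colouring of $K_n$ has $|P|=g$, $R\cup P$ is $K_s$-free and $B\cup P$ is $K_t$-free; for non-integer arguments $g(n;s,t):=g(n;\lceil s\rceil,\lceil t\rceil)$.
   Formalization: The constant c (and the error ε in the o(1) term) ranges over rational numbers only; the case of real c follows since g(n;3,t) is nondecreasing in t, by approximating c from below by rationals. -}

module Defs where

open import Data.Nat using (ℕ; zero; suc; _+_; _<ᵇ_)
open import Data.Bool using (Bool; true; false; if_then_else_; _∧_)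
open import Data.Fin using (Fin; toℕ)
open import Data.List using (List; map; allFin)
open import Data.Nat.ListAction using (sum)
open import Data.Unit using (⊤)
open import Data.Product using (Σ; _×_; _,_)
open import Data.Empty using (⊥)
open import Data.Integer using (ℤ; ∣_∣; +_)
open import Data.Rational using (ℚ; _/_; _*_; ceiling)
open import Function.Definitions using (Injective)
open import Relation.Binary.PropositionalEquality using (_≡_; _≢_)
open import Relation.Nullary using (¬_)

data Colour : Set where
  red blue purple : Colour

-- A red/blue/purple colouring of the edges of K_n: a symmetric colour
-- assignment to pairs of vertices (the diagonal value is irrelevant).
record Colouring (n : ℕ) : Set where
  field
    col : Fin n → Fin n → Colour
    sym : ∀ i j → col i j ≡ col j i
open Colouring public

isPurple : Colour → Bool
isPurple purple = true
isPurple _      = false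

purpleCount : ∀ {n} → Colouring n → ℕ
purpleCount {n} χ =
  sum (map (λ i → sum (map (λ j →
    if (toℕ i <ᵇ toℕ j) ∧ isPurple (col χ i j) then 1 else 0) (allFin n))) (allFin n))

RedOrPurple : Colour → Set
RedOrPurple blue = ⊥
RedOrPurple _    = ⊤

BlueOrPurple : Colour → Set
BlueOrPurple red = ⊥
BlueOrPurple _   = ⊤

HasClique : ∀ {n} → (Colour → Set) → Colouring n → ℕ → Set
HasClique {n} E χ k =
  Σ (Fin k → Fin n) λ f → Injective _≡_ _≡_ f × (∀ a b → a ≢ b → E (col χ (f a) (f b)))

KFree : ∀ {n} → (Colour → Set) → Colouring n → ℕ → Set
KFree E χ k = ¬ HasClique E χ k

ℕtoℚ : ℕ → ℚ
ℕtoℚ m = (+ m) / 1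

-- ⌈ q ⌉ as a natural number (q ≥ 0 in all uses)
ceilℕ : ℚ → ℕ
ceilℕ q = ∣ ceiling q ∣

-- "g(n; s, t) ≥ x": some colouring of K_n with R∪P K_s-free, B∪P K_t-free
-- and |P| ≥ x (g is the maximum of |P| over such colourings).
gAtLeast : ℕ → ℕ → ℕ → ℚ → Set
gAtLeast n s t x =
  Σ (Colouring n) λ χ → KFree RedOrPurple χ s × KFree BlueOrPurple χ t
    × (x Data.Rational.≤ ℕtoℚ (purpleCount χ))

{-# OPTIONS --safe #-}
module Submission where

-- Call a triangle-free graph with M (weighted) vertices balanced if all degrees
-- are at least D and no independent set is larger than D.  Let the vertices of
-- a balanced graph be blown up and let every edge become a sparse bipartite red
-- graph without large empty rectangles, together with its purple bipartite
-- complement.  Red ∪ purple is triangle-free, a set without red edges has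
-- relative size at most D/M + o(1), and purple has density D/M − o(1).  So it
-- suffices that the ratios M/D are dense in [3, ∞).
--
-- The circulant graph on ℤ_m with distances in [k, 2k) is balanced with D = 2k
-- for 6k ≤ m ≤ 8k − 3, which gives a dense set of ratios in [3, 4].  A suitably
-- weighted Mycielski construction turns a ratio x into x + 1/x; this map is
-- increasing and 1-Lipschitz on [1, ∞) and sends 3 below 4, so its iterates on
-- [3, 4] cover [3, ∞).
--
-- The sparse red graph joins words of length d over q letters that agree in
-- some position.  If two sets of words have no red edge between them, they use
-- disjoint sets of letters in every position, so one of them has density at
-- most 2⁻ᵈ, whereas the red density is at most d/q.

open import Defs hiding (sym)

-- Neighbourhoods in a triangle-free graph are independent, so the two conditions of balance force
-- every degree to equal D. This is why one number D/M controls both the sets without red edges and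
-- the purple density, and why c ≤ 1/3 enters: the circulant ratios M/D start at 3. For c = p/r and
-- a precision 1/h the graph is chosen with r/p < M/D ≤ r/p + 1/h. The inequality on the left is
-- strict because the sets without red edges must stay below cn: the fixed gap between D/M and c
-- pays for the fibres of density 2⁻ᵈ and for spreading n vertices unevenly over the labels.
-- Closeness on the right costs only O(1/h) of the purple density. The word graph is an explicit
-- substitute for a sparse random bipartite graph. Its two parameters decouple the two demands: d
-- alone makes empty rectangles small, and q can afterwards be taken so large that the red density
-- d/q is at most 1/h. The choices are made in the order G, d, q, n, each depending on the previous
-- ones. All ratios are cross-multiplied, so the combinatorial part lives in ℕ.

module Construction where
  open import Data.Bool using (Bool; true; false; if_then_else_; _∧_; _∨_; not; T)
  open import Data.Bool.ListAction using (any)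
  open import Data.Bool.Properties using (T-∨; T-∧; T?; ∨-comm)
  open import Data.Empty using (⊥; ⊥-elim)
  open import Data.Fin as Fin using (Fin; toℕ)
  import Data.Fin.Properties as Finₚ
  open import Data.List using (List; []; _∷_; _++_; map; allFin; length; concat; replicate; cartesianProduct; cartesianProductWith; lookup; upTo; tabulate; applyUpTo)
  open import Data.List.Membership.Propositional using (_∈_; lose; find)
  open import Data.List.Membership.Propositional.Properties using (∈-cartesianProductWith⁺; ∈-allFin)
  open import Data.List.Properties using (map-tabulate; tabulate-lookup; length-tabulate; length-upTo)
  open import Data.List.Relation.Unary.Any using (here; there)
  open import Data.List.Relation.Unary.Any.Properties using (any⁺; any⁻)
  open import Data.Nat using (ℕ; zero; suc; pred; _+_; _*_; _∸_; _^_; _/_; _%_; _≤_; _<_; _<ᵇ_; z≤n; s≤s; NonZero; >-nonZero)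
  open import Data.Nat.DivMod using (_mod_; m≡m%n+[m/n]*n; m%n<n; m<n⇒m%n≡m; m/n*n≤m; [m+n]%n≡m%n; %-distribˡ-+; m%n%n≡m%n)
  open import Data.Nat.Divisibility using (_∣_; divides; ∣m+n∣m⇒∣n; ∣⇒≤)
  open import Data.Nat.ListAction using (sum)
  open import Data.Nat.Properties hiding (_≟_)
  import Data.Nat.Properties as ℕₚ
  open import Data.Nat.Tactic.RingSolver using (solve-∀)
  open import Data.Product using (Σ; ∃; _×_; _,_; proj₁; proj₂)
  open import Data.Product.Properties using (≡-dec)
  open import Data.Sum using (_⊎_; inj₁; inj₂)
  open import Data.Unit using (tt)
  open import Data.Vec using (Vec; []; _∷_)
  import Data.Vec.Properties as Vecₚ
  open import Function using (_∘_; Equivalence)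
  open import Relation.Binary.Definitions using (DecidableEquality; tri<; tri≈; tri>)
  open import Relation.Binary.PropositionalEquality
  open import Relation.Nullary using (¬_; Dec; yes; no)
  open import Relation.Nullary.Decidable using (⌊_⌋; toWitness; fromWitness)
  open import Relation.Unary using (Decidable)

  -- Finite sums

  private variable
    A B C : Set

  ⟦_⟧ : Bool → ℕ
  ⟦ b ⟧ = if b then 1 else 0

  ⟦⟧-mono : ∀ a b → (T a → T b) → ⟦ a ⟧ ≤ ⟦ b ⟧
  ⟦⟧-mono false _     _ = z≤n
  ⟦⟧-mono true  true  _ = ≤-refl
  ⟦⟧-mono true  false h = ⊥-elim (h tt)

  ⟦⟧≤1 : ∀ a → ⟦ a ⟧ ≤ 1
  ⟦⟧≤1 true  = ≤-refl
  ⟦⟧≤1 false = z≤n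

  ⟦⟧-true : ∀ a → T a → ⟦ a ⟧ ≡ 1
  ⟦⟧-true true _ = refl

  ⟦⟧-false : ∀ a → ¬ T a → ⟦ a ⟧ ≡ 0
  ⟦⟧-false true  h = ⊥-elim (h tt)
  ⟦⟧-false false _ = refl

  ⟦⟧-∧ : ∀ a b → ⟦ a ∧ b ⟧ ≡ ⟦ a ⟧ * ⟦ b ⟧
  ⟦⟧-∧ true  b = sym (+-identityʳ ⟦ b ⟧)
  ⟦⟧-∧ false b = refl

  ⟦⟧-disjoint : ∀ a b → (T a → T b → ⊥) → ⟦ a ⟧ + ⟦ b ⟧ ≤ 1
  ⟦⟧-disjoint true  true  h = ⊥-elim (h tt tt)
  ⟦⟧-disjoint true  false h = ≤-refl
  ⟦⟧-disjoint false b     h = ⟦⟧≤1 b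

  ⟦⟧-not : ∀ a → ⟦ not a ⟧ + ⟦ a ⟧ ≡ 1
  ⟦⟧-not true  = refl
  ⟦⟧-not false = refl

  ∑ : List A → (A → ℕ) → ℕ
  ∑ xs f = sum (map f xs)

  ∑-cong : ∀ (xs : List A) {f g : A → ℕ} → (∀ x → f x ≡ g x) → ∑ xs f ≡ ∑ xs g
  ∑-cong []       h = refl
  ∑-cong (x ∷ xs) h = cong₂ _+_ (h x) (∑-cong xs h)

  ∑-mono : ∀ (xs : List A) {f g : A → ℕ} → (∀ x → f x ≤ g x) → ∑ xs f ≤ ∑ xs g
  ∑-mono []       h = z≤n
  ∑-mono (x ∷ xs) h = +-mono-≤ (h x) (∑-mono xs h)

  ∑-+ : ∀ (xs : List A) (f g : A → ℕ) → ∑ xs (λ x → f x + g x) ≡ ∑ xs f + ∑ xs g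
  ∑-+ []       f g = refl
  ∑-+ (x ∷ xs) f g = trans (cong (f x + g x +_) (∑-+ xs f g)) (interchange (f x) (g x) (∑ xs f) (∑ xs g))
    where
    interchange : ∀ a b c d → a + b + (c + d) ≡ a + c + (b + d)
    interchange = solve-∀

  ∑-* : ∀ (xs : List A) k (f : A → ℕ) → ∑ xs (λ x → k * f x) ≡ k * ∑ xs f
  ∑-* []       k f = sym (*-zeroʳ k)
  ∑-* (x ∷ xs) k f = trans (cong (k * f x +_) (∑-* xs k f)) (sym (*-distribˡ-+ k (f x) (∑ xs f)))

  ∑-const : ∀ (xs : List A) k → ∑ xs (λ _ → k) ≡ length xs * k
  ∑-const []       k = refl
  ∑-const (x ∷ xs) k = cong (k +_) (∑-const xs k)

  ∑-0 : ∀ (xs : List A) → ∑ xs (λ _ → 0) ≡ 0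
  ∑-0 xs = trans (∑-const xs 0) (*-zeroʳ (length xs))

  ∑-++ : ∀ (xs ys : List A) f → ∑ (xs ++ ys) f ≡ ∑ xs f + ∑ ys f
  ∑-++ []       ys f = refl
  ∑-++ (x ∷ xs) ys f = trans (cong (f x +_) (∑-++ xs ys f)) (sym (+-assoc (f x) _ _))

  ∑-map : ∀ (g : A → B) xs f → ∑ (map g xs) f ≡ ∑ xs (f ∘ g)
  ∑-map g []       f = refl
  ∑-map g (x ∷ xs) f = cong (f (g x) +_) (∑-map g xs f)

  ∑-swap : ∀ (xs : List A) (ys : List B) (f : A → B → ℕ) →
    ∑ xs (λ x → ∑ ys (f x)) ≡ ∑ ys (λ y → ∑ xs (λ x → f x y))
  ∑-swap []       ys f = sym (∑-0 ys)
  ∑-swap (x ∷ xs) ys f =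
    trans (cong (∑ ys (f x) +_) (∑-swap xs ys f)) (sym (∑-+ ys (f x) _))

  ∑-cartesianProductWith : ∀ (g : A → B → C) xs ys f →
    ∑ (cartesianProductWith g xs ys) f ≡ ∑ xs (λ x → ∑ ys (λ y → f (g x y)))
  ∑-cartesianProductWith g []       ys f = refl
  ∑-cartesianProductWith g (x ∷ xs) ys f =
    trans (∑-++ (map (g x) ys) _ f)
          (cong₂ _+_ (∑-map (g x) ys f) (∑-cartesianProductWith g xs ys f))

  ∑-product : ∀ (xs : List A) (ys : List B) (f : A → ℕ) (g : B → ℕ) →
    ∑ xs (λ x → ∑ ys (λ y → f x * g y)) ≡ ∑ xs f * ∑ ys g
  ∑-product xs ys f g =
    trans (∑-cong xs (λ x → trans (∑-* ys (f x) g) (*-comm (f x) (∑ ys g))))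
          (trans (∑-* xs (∑ ys g) f) (*-comm (∑ ys g) (∑ xs f)))

  copies : ℕ → List A → List A
  copies k xs = concat (replicate k xs)

  ∑-copies : ∀ k (xs : List A) f → ∑ (copies k xs) f ≡ k * ∑ xs f
  ∑-copies zero    xs f = refl
  ∑-copies (suc k) xs f = trans (∑-++ xs (copies k xs) f) (cong (∑ xs f +_) (∑-copies k xs f))

  length-as-∑ : ∀ (xs : List A) → length xs ≡ ∑ xs (λ _ → 1)
  length-as-∑ xs = sym (trans (∑-const xs 1) (*-identityʳ (length xs)))

  ∑< : ℕ → (ℕ → ℕ) → ℕ
  ∑< zero    f = 0
  ∑< (suc n) f = f 0 + ∑< n (f ∘ suc)

  ∑<-cong : ∀ n {f g : ℕ → ℕ} → (∀ i → i < n → f i ≡ g i) → ∑< n f ≡ ∑< n g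
  ∑<-cong zero    h = refl
  ∑<-cong (suc n) h = cong₂ _+_ (h 0 (s≤s z≤n)) (∑<-cong n (λ i i<n → h (suc i) (s≤s i<n)))

  ∑<-mono : ∀ n {f g : ℕ → ℕ} → (∀ i → i < n → f i ≤ g i) → ∑< n f ≤ ∑< n g
  ∑<-mono zero    h = z≤n
  ∑<-mono (suc n) h = +-mono-≤ (h 0 (s≤s z≤n)) (∑<-mono n (λ i i<n → h (suc i) (s≤s i<n)))

  ∑<-const : ∀ n k → ∑< n (λ _ → k) ≡ n * k
  ∑<-const zero    k = refl
  ∑<-const (suc n) k = cong (k +_) (∑<-const n k)

  ∑<-split : ∀ a b f → ∑< (a + b) f ≡ ∑< a f + ∑< b (λ i → f (a + i))
  ∑<-split zero    b f = refl
  ∑<-split (suc a) b f = trans (cong (f 0 +_) (∑<-split a b (f ∘ suc))) (sym (+-assoc (f 0) _ _))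

  ∑<-monoˡ : ∀ {m n} f → m ≤ n → ∑< m f ≤ ∑< n f
  ∑<-monoˡ {m} {n} f m≤n = begin
    ∑< m f                                    ≤⟨ m≤m+n _ _ ⟩
    ∑< m f + ∑< (n ∸ m) (λ i → f (m + i))     ≡⟨ ∑<-split m (n ∸ m) f ⟨
    ∑< (m + (n ∸ m)) f                        ≡⟨ cong (λ k → ∑< k f) (m+[n∸m]≡n m≤n) ⟩
    ∑< n f                                    ∎
    where open ≤-Reasoning

  ∑<-+ : ∀ n (f g : ℕ → ℕ) → ∑< n (λ i → f i + g i) ≡ ∑< n f + ∑< n g
  ∑<-+ zero    f g = refl
  ∑<-+ (suc n) f g = trans (cong (f 0 + g 0 +_) (∑<-+ n (f ∘ suc) (g ∘ suc))) (interchange (f 0) (g 0) _ _)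
    where
    interchange : ∀ a b c d → a + b + (c + d) ≡ a + c + (b + d)
    interchange = solve-∀

  ∑-tabulate : ∀ n (g : Fin n → A) f → ∑ (tabulate g) f ≡ ∑ (allFin n) (f ∘ g)
  ∑-tabulate n g f = cong sum (trans (map-tabulate g f) (sym (map-tabulate (λ i → i) (f ∘ g))))

  ∑-allFin-suc : ∀ n (f : Fin (suc n) → ℕ) → ∑ (allFin (suc n)) f ≡ f Fin.zero + ∑ (allFin n) (f ∘ Fin.suc)
  ∑-allFin-suc n f = cong (f Fin.zero +_) (∑-tabulate n Fin.suc f)

  ∑-allFin : ∀ n f → ∑ (allFin n) (f ∘ toℕ) ≡ ∑< n f
  ∑-allFin zero    f = refl
  ∑-allFin (suc n) f = trans (∑-allFin-suc n (f ∘ toℕ)) (cong (f 0 +_) (∑-allFin n (f ∘ suc)))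

  ∑-applyUpTo : ∀ n (g : ℕ → ℕ) f → ∑ (applyUpTo g n) f ≡ ∑< n (f ∘ g)
  ∑-applyUpTo zero    g f = refl
  ∑-applyUpTo (suc n) g f = cong (f (g 0) +_) (∑-applyUpTo n (g ∘ suc) f)

  ∑-lookup : ∀ (xs : List A) f → ∑ (allFin (length xs)) (f ∘ lookup xs) ≡ ∑ xs f
  ∑-lookup xs f = trans (sym (∑-tabulate (length xs) (lookup xs) f)) (cong (λ l → ∑ l f) (tabulate-lookup xs))

  ∑-subsingleton : ∀ n (p : Fin n → Bool) → (∀ a b → T (p a) → T (p b) → a ≡ b) →
    ∑ (allFin n) (λ a → ⟦ p a ⟧) ≤ 1
  ∑-subsingleton zero    p h = z≤n
  ∑-subsingleton (suc n) p h with T? (p Fin.zero)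
  ... | no ¬p0 = begin
    ∑ (allFin (suc n)) (λ a → ⟦ p a ⟧)                       ≡⟨ ∑-allFin-suc n (λ a → ⟦ p a ⟧) ⟩
    ⟦ p Fin.zero ⟧ + ∑ (allFin n) (λ a → ⟦ p (Fin.suc a) ⟧)  ≡⟨ cong (_+ ∑ (allFin n) (λ a → ⟦ p (Fin.suc a) ⟧)) (⟦⟧-false _ ¬p0) ⟩
    ∑ (allFin n) (λ a → ⟦ p (Fin.suc a) ⟧)                   ≤⟨ ∑-subsingleton n (p ∘ Fin.suc) (λ a b pa pb → Finₚ.suc-injective (h _ _ pa pb)) ⟩
    1                                                        ∎
    where open ≤-Reasoning
  ... | yes p0 = begin
    ∑ (allFin (suc n)) (λ a → ⟦ p a ⟧)                       ≡⟨ ∑-allFin-suc n (λ a → ⟦ p a ⟧) ⟩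
    ⟦ p Fin.zero ⟧ + ∑ (allFin n) (λ a → ⟦ p (Fin.suc a) ⟧)  ≤⟨ +-mono-≤ (⟦⟧≤1 (p Fin.zero)) (∑-mono (allFin n) others) ⟩
    1 + ∑ (allFin n) (λ _ → 0)                               ≡⟨ cong suc (∑-0 (allFin n)) ⟩
    1                                                        ∎
    where
    open ≤-Reasoning
    others : ∀ a → ⟦ p (Fin.suc a) ⟧ ≤ 0
    others a = ≤-reflexive (⟦⟧-false _ (λ pa → Finₚ.0≢1+n (h Fin.zero (Fin.suc a) p0 pa)))

  -- Balanced graphs and the Mycielski construction

  Independent : {V : Set} → (V → V → Bool) → (V → Bool) → Set
  Independent E s = ∀ x y → T (s x) → T (s y) → ¬ T (E x y)

  -- Vertices are listed with multiplicity, i.e. the list encodes integer vertex weights.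
  record Balanced : Set₁ where
    field
      V             : Set
      _≟_           : DecidableEquality V
      E             : V → V → Bool
      E-sym         : ∀ x y → E x y ≡ E y x
      triangle-free : ∀ x y z → T (E x y) → T (E y z) → ¬ T (E x z)
      verts         : List V
      D             : ℕ
      D>0           : 0 < D
      D≤M           : D ≤ length verts
      degree        : ∀ v → D ≤ ∑ verts (λ u → ⟦ E v u ⟧)
      independence  : ∀ s → Independent E s → ∑ verts (λ u → ⟦ s u ⟧) ≤ D

    M : ℕ
    M = length verts

    irreflexive : ∀ x → ¬ T (E x x)
    irreflexive x e = triangle-free x x x e e e

  data Cone (V : Set) : Set where
    base twin : V → Cone V
    apex      : Cone V

  module Mycielski (G : Balanced) where
    open Balanced G
    open ≤-Reasoning

    private
      _≟ᶜ_ : DecidableEquality (Cone V)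
      base x ≟ᶜ base y with x ≟ y
      ... | yes refl = yes refl
      ... | no  x≢y  = no λ { refl → x≢y refl }
      twin x ≟ᶜ twin y with x ≟ y
      ... | yes refl = yes refl
      ... | no  x≢y  = no λ { refl → x≢y refl }
      apex   ≟ᶜ apex   = yes refl
      base _ ≟ᶜ twin _ = no λ ()
      base _ ≟ᶜ apex   = no λ ()
      twin _ ≟ᶜ base _ = no λ ()
      twin _ ≟ᶜ apex   = no λ ()
      apex   ≟ᶜ base _ = no λ ()
      apex   ≟ᶜ twin _ = no λ ()

      Eᶜ : Cone V → Cone V → Bool
      Eᶜ (base x) (base y) = E x y
      Eᶜ (base x) (twin y) = E x y
      Eᶜ (twin x) (base y) = E x y
      Eᶜ (twin x) apex     = true
      Eᶜ apex     (twin y) = true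
      Eᶜ _        _        = false

      Eᶜ-sym : ∀ x y → Eᶜ x y ≡ Eᶜ y x
      Eᶜ-sym (base x) (base y) = E-sym x y
      Eᶜ-sym (base x) (twin y) = E-sym x y
      Eᶜ-sym (base x) apex     = refl
      Eᶜ-sym (twin x) (base y) = E-sym x y
      Eᶜ-sym (twin x) (twin y) = refl
      Eᶜ-sym (twin x) apex     = refl
      Eᶜ-sym apex     (base y) = refl
      Eᶜ-sym apex     (twin y) = refl
      Eᶜ-sym apex     apex     = refl

      triangle-freeᶜ : ∀ x y z → T (Eᶜ x y) → T (Eᶜ y z) → ¬ T (Eᶜ x z)
      triangle-freeᶜ (base x) (base y) (base z) p q r = triangle-free x y z p q r
      triangle-freeᶜ (base x) (base y) (twin z) p q r = triangle-free x y z p q r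
      triangle-freeᶜ (base x) (twin y) (base z) p q r = triangle-free x y z p q r
      triangle-freeᶜ (twin x) (base y) (base z) p q r = triangle-free x y z p q r
      triangle-freeᶜ (base x) (base y) apex     p () r
      triangle-freeᶜ (base x) (twin y) (twin z) p () r
      triangle-freeᶜ (base x) (twin y) apex     p q ()
      triangle-freeᶜ (base x) apex     z        () q r
      triangle-freeᶜ (twin x) (base y) (twin z) p q ()
      triangle-freeᶜ (twin x) (base y) apex     p () r
      triangle-freeᶜ (twin x) (twin y) z        () q r
      triangle-freeᶜ (twin x) apex     (base z) p () r
      triangle-freeᶜ (twin x) apex     (twin z) p q ()
      triangle-freeᶜ (twin x) apex     apex     p () r
      triangle-freeᶜ apex     (base y) z        () q r
      triangle-freeᶜ apex     (twin y) (base z) p q ()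
      triangle-freeᶜ apex     (twin y) (twin z) p () r
      triangle-freeᶜ apex     (twin y) apex     p q ()
      triangle-freeᶜ apex     apex     z        () q r

      -- These weights are forced by equality of all degrees when G is D-regular.
      vertsᶜ : List (Cone V)
      vertsᶜ = copies (M ∸ D) (map base verts) ++ copies D (map twin verts) ++ replicate (D * D) apex

      ∑-replicate : ∀ k (x : Cone V) f → ∑ (replicate k x) f ≡ k * f x
      ∑-replicate zero    x f = refl
      ∑-replicate (suc k) x f = cong (f x +_) (∑-replicate k x f)

      ∑-vertsᶜ : ∀ f → ∑ vertsᶜ f ≡
        (M ∸ D) * ∑ verts (f ∘ base) + (D * ∑ verts (f ∘ twin) + D * D * f apex)
      ∑-vertsᶜ f =
        trans (∑-++ (copies (M ∸ D) (map base verts)) _ f) (cong₂ _+_ (part (M ∸ D) base)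
          (trans (∑-++ (copies D (map twin verts)) _ f) (cong₂ _+_ (part D twin) (∑-replicate (D * D) apex f))))
        where
        part : ∀ k (g : V → Cone V) → ∑ (copies k (map g verts)) f ≡ k * ∑ verts (f ∘ g)
        part k g = trans (∑-copies k (map g verts) f) (cong (k *_) (∑-map g verts f))

      M-split : ∀ k → (M ∸ D) * k + D * k ≡ M * k
      M-split k = trans (sym (*-distribʳ-+ k (M ∸ D) D)) (cong (_* k) (m∸n+n≡m D≤M))

      length-vertsᶜ : length vertsᶜ ≡ M * M + D * D
      length-vertsᶜ = begin-equality
        length vertsᶜ                                    ≡⟨ length-as-∑ vertsᶜ ⟩
        ∑ vertsᶜ (λ _ → 1)                               ≡⟨ ∑-vertsᶜ (λ _ → 1) ⟩
        (M ∸ D) * m + (D * m + D * D * 1)                ≡⟨ +-assoc ((M ∸ D) * m) (D * m) _ ⟨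
        (M ∸ D) * m + D * m + D * D * 1                  ≡⟨ cong₂ _+_ (M-split m) (*-identityʳ (D * D)) ⟩
        M * m + D * D                                    ≡⟨ cong (λ k → M * k + D * D) (length-as-∑ verts) ⟨
        M * M + D * D                                    ∎
        where m = ∑ verts (λ _ → 1)

      degreeᶜ : ∀ v → M * D ≤ ∑ vertsᶜ (λ u → ⟦ Eᶜ v u ⟧)
      degreeᶜ (base v) = begin
        M * D                                            ≡⟨ M-split D ⟨
        (M ∸ D) * D + D * D                              ≤⟨ +-mono-≤ (*-monoʳ-≤ (M ∸ D) (degree v)) (≤-trans (*-monoʳ-≤ D (degree v)) (m≤m+n _ _)) ⟩
        _                                                ≡⟨ ∑-vertsᶜ (λ u → ⟦ Eᶜ (base v) u ⟧) ⟨
        ∑ vertsᶜ (λ u → ⟦ Eᶜ (base v) u ⟧)               ∎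
      degreeᶜ (twin v) = begin
        M * D                                            ≡⟨ M-split D ⟨
        (M ∸ D) * D + D * D                              ≤⟨ +-mono-≤ (*-monoʳ-≤ (M ∸ D) (degree v)) (≤-trans (≤-reflexive (sym (*-identityʳ (D * D)))) (m≤n+m _ _)) ⟩
        _                                                ≡⟨ ∑-vertsᶜ (λ u → ⟦ Eᶜ (twin v) u ⟧) ⟨
        ∑ vertsᶜ (λ u → ⟦ Eᶜ (twin v) u ⟧)               ∎
      degreeᶜ apex = begin
        M * D                                            ≡⟨ *-comm M D ⟩
        D * M                                            ≡⟨ cong (D *_) (length-as-∑ verts) ⟩
        D * ∑ verts (λ _ → 1)                            ≤⟨ m≤m+n _ _ ⟩
        D * ∑ verts (λ _ → 1) + D * D * 0                ≤⟨ m≤n+m _ ((M ∸ D) * ∑ verts (λ _ → 0)) ⟩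
        _                                                ≡⟨ ∑-vertsᶜ (λ u → ⟦ Eᶜ apex u ⟧) ⟨
        ∑ vertsᶜ (λ u → ⟦ Eᶜ apex u ⟧)                   ∎

      -- For every v the set A ∪ (N(v) ∩ B) is independent; average over v.
      expansion : ∀ (A B : V → Bool) → Independent E A → (∀ x y → T (A x) → T (B y) → ¬ T (E x y)) →
        (M ∸ D) * ∑ verts (λ x → ⟦ A x ⟧) + D * ∑ verts (λ x → ⟦ B x ⟧) ≤ M * D
      expansion A B A-ind A-B = begin
        (M ∸ D) * a + D * b                              ≤⟨ +-monoʳ-≤ ((M ∸ D) * a) (*-monoʳ-≤ D b≤a+y) ⟩
        (M ∸ D) * a + D * (a + y)                        ≡⟨ cong ((M ∸ D) * a +_) (*-distribˡ-+ D a y) ⟩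
        (M ∸ D) * a + (D * a + D * y)                    ≡⟨ +-assoc ((M ∸ D) * a) (D * a) (D * y) ⟨
        (M ∸ D) * a + D * a + D * y                      ≡⟨ cong (_+ D * y) (M-split a) ⟩
        M * a + D * y                                    ≤⟨ +-monoʳ-≤ (M * a) double-count ⟩
        M * a + ∑ verts (λ v → ∑ verts (λ x → ⟦ Y x ⟧ * ⟦ E v x ⟧))
          ≡⟨ cong (_+ ∑ verts (λ v → ∑ verts (λ x → ⟦ Y x ⟧ * ⟦ E v x ⟧))) (∑-const verts a) ⟨
        ∑ verts (λ _ → a) + ∑ verts (λ v → ∑ verts (λ x → ⟦ Y x ⟧ * ⟦ E v x ⟧))
          ≡⟨ ∑-+ verts _ _ ⟨
        ∑ verts (λ v → a + ∑ verts (λ x → ⟦ Y x ⟧ * ⟦ E v x ⟧))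
          ≤⟨ ∑-mono verts local ⟩
        ∑ verts (λ _ → D)                                ≡⟨ ∑-const verts D ⟩
        M * D                                            ∎
        where
        -- With `A` removed from `B` the sets A and N(v) ∩ Y are disjoint, so their sizes add up
        -- inside one independent set. As b ≤ a + y, it is enough to bound M·a + D·y.
        Y : V → Bool
        Y x = B x ∧ not (A x)
        a = ∑ verts (λ x → ⟦ A x ⟧)
        b = ∑ verts (λ x → ⟦ B x ⟧)
        y = ∑ verts (λ x → ⟦ Y x ⟧)

        b≤a+y : b ≤ a + y
        b≤a+y = ≤-trans (∑-mono verts (λ x → pointwise (A x) (B x))) (≤-reflexive (∑-+ verts _ _))
          where
          pointwise : ∀ p q → ⟦ q ⟧ ≤ ⟦ p ⟧ + ⟦ q ∧ not p ⟧
          pointwise true  q     = ≤-trans (⟦⟧≤1 q) (m≤m+n 1 _)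
          pointwise false true  = ≤-refl
          pointwise false false = ≤-refl

        double-count : D * y ≤ ∑ verts (λ v → ∑ verts (λ x → ⟦ Y x ⟧ * ⟦ E v x ⟧))
        double-count = begin
          D * y                                                        ≡⟨ ∑-* verts D (λ x → ⟦ Y x ⟧) ⟨
          ∑ verts (λ x → D * ⟦ Y x ⟧)                                  ≤⟨ ∑-mono verts (λ x → *-monoˡ-≤ ⟦ Y x ⟧ (degree x)) ⟩
          ∑ verts (λ x → ∑ verts (λ v → ⟦ E x v ⟧) * ⟦ Y x ⟧)          ≡⟨ ∑-cong verts (λ x → *-comm _ ⟦ Y x ⟧) ⟩
          ∑ verts (λ x → ⟦ Y x ⟧ * ∑ verts (λ v → ⟦ E x v ⟧))          ≡⟨ ∑-cong verts (λ x → ∑-* verts ⟦ Y x ⟧ (λ v → ⟦ E x v ⟧)) ⟨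
          ∑ verts (λ x → ∑ verts (λ v → ⟦ Y x ⟧ * ⟦ E x v ⟧))          ≡⟨ ∑-cong verts (λ x → ∑-cong verts (λ v → cong (λ e → ⟦ Y x ⟧ * ⟦ e ⟧) (E-sym x v))) ⟩
          ∑ verts (λ x → ∑ verts (λ v → ⟦ Y x ⟧ * ⟦ E v x ⟧))          ≡⟨ ∑-swap verts verts (λ x v → ⟦ Y x ⟧ * ⟦ E v x ⟧) ⟩
          ∑ verts (λ v → ∑ verts (λ x → ⟦ Y x ⟧ * ⟦ E v x ⟧))          ∎

        local : ∀ v → a + ∑ verts (λ x → ⟦ Y x ⟧ * ⟦ E v x ⟧) ≤ D
        local v = begin
          a + ∑ verts (λ x → ⟦ Y x ⟧ * ⟦ E v x ⟧)                      ≡⟨ ∑-+ verts _ _ ⟨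
          ∑ verts (λ x → ⟦ A x ⟧ + ⟦ Y x ⟧ * ⟦ E v x ⟧)                ≤⟨ ∑-mono verts (λ x → pointwise (A x) (B x) (E v x)) ⟩
          ∑ verts (λ x → ⟦ S x ⟧)                                      ≤⟨ independence S S-ind ⟩
          D                                                            ∎
          where
          S : V → Bool
          S x = A x ∨ (B x ∧ E v x)
          pointwise : ∀ p q r → ⟦ p ⟧ + ⟦ q ∧ not p ⟧ * ⟦ r ⟧ ≤ ⟦ p ∨ (q ∧ r) ⟧
          pointwise true  true  r     = ≤-refl
          pointwise true  false r     = ≤-refl
          pointwise false true  true  = ≤-refl
          pointwise false true  false = ≤-refl
          pointwise false false r     = z≤n
          S-ind : Independent E S
          S-ind x z sx sz e with Equivalence.to (T-∨ {A x}) sx | Equivalence.to (T-∨ {A z}) sz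
          ... | inj₁ ax | inj₁ az = A-ind x z ax az e
          ... | inj₁ ax | inj₂ t  = A-B x z ax (proj₁ (Equivalence.to (T-∧ {B z}) t)) e
          ... | inj₂ t  | inj₁ az = A-B z x az (proj₁ (Equivalence.to (T-∧ {B x}) t)) (subst T (E-sym x z) e)
          ... | inj₂ t  | inj₂ t′ = triangle-free v x z (proj₂ (Equivalence.to (T-∧ {B x}) t)) e (proj₂ (Equivalence.to (T-∧ {B z}) t′))

      -- The apex excludes every twin; its weight D² together with (M - D)·D from the base part is
      -- exactly M·D. Without the apex, the base part is independent and sends no edge to the base
      -- shadows of the chosen twins, which is the situation of `expansion`.
      independenceᶜ : ∀ s → Independent Eᶜ s → ∑ vertsᶜ (λ u → ⟦ s u ⟧) ≤ M * D
      independenceᶜ s s-ind with T? (s apex)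
      ... | yes sa = begin
        ∑ vertsᶜ (λ u → ⟦ s u ⟧)                         ≡⟨ ∑-vertsᶜ (λ u → ⟦ s u ⟧) ⟩
        (M ∸ D) * a + (D * b + D * D * ⟦ s apex ⟧)       ≤⟨ +-mono-≤ (*-monoʳ-≤ (M ∸ D) a≤D) (+-mono-≤ (≤-reflexive (trans (cong (D *_) b≡0) (*-zeroʳ D))) (*-monoʳ-≤ (D * D) (⟦⟧≤1 (s apex)))) ⟩
        (M ∸ D) * D + D * D * 1                          ≡⟨ cong ((M ∸ D) * D +_) (*-identityʳ (D * D)) ⟩
        (M ∸ D) * D + D * D                              ≡⟨ M-split D ⟩
        M * D                                            ∎
        where
        a = ∑ verts (λ x → ⟦ s (base x) ⟧)
        b = ∑ verts (λ x → ⟦ s (twin x) ⟧)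
        a≤D : a ≤ D
        a≤D = independence (s ∘ base) (λ x y → s-ind (base x) (base y))
        b≡0 : b ≡ 0
        b≡0 = trans (∑-cong verts (λ x → ⟦⟧-false _ (λ sx → s-ind (twin x) apex sx sa tt))) (∑-0 verts)
      ... | no ¬sa = begin
        ∑ vertsᶜ (λ u → ⟦ s u ⟧)                         ≡⟨ ∑-vertsᶜ (λ u → ⟦ s u ⟧) ⟩
        (M ∸ D) * a + (D * b + D * D * ⟦ s apex ⟧)       ≡⟨ cong (λ k → (M ∸ D) * a + (D * b + D * D * k)) (⟦⟧-false (s apex) ¬sa) ⟩
        (M ∸ D) * a + (D * b + D * D * 0)                ≡⟨ cong ((M ∸ D) * a +_) (trans (cong (D * b +_) (*-zeroʳ (D * D))) (+-identityʳ (D * b))) ⟩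
        (M ∸ D) * a + D * b                              ≤⟨ expansion (s ∘ base) (s ∘ twin) (λ x y → s-ind (base x) (base y)) (λ x y → s-ind (base x) (twin y)) ⟩
        M * D                                            ∎
        where
        a = ∑ verts (λ x → ⟦ s (base x) ⟧)
        b = ∑ verts (λ x → ⟦ s (twin x) ⟧)

    cone : Balanced
    cone = record
      { V = Cone V ; _≟_ = _≟ᶜ_ ; E = Eᶜ ; E-sym = Eᶜ-sym ; triangle-free = triangle-freeᶜ
      ; verts = vertsᶜ ; D = M * D ; D>0 = *-mono-≤ (≤-trans D>0 D≤M) D>0
      ; D≤M = ≤-trans (*-monoʳ-≤ M D≤M) (≤-trans (m≤m+n (M * M) (D * D)) (≤-reflexive (sym length-vertsᶜ)))
      ; degree = degreeᶜ ; independence = independenceᶜ }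

    M-cone : Balanced.M cone ≡ M * M + D * D
    M-cone = length-vertsᶜ

  -- Circulant graphs

  ∑<-rotate : ∀ m (f : ℕ → ℕ) → (∀ i → f (i + m) ≡ f i) → ∀ a → ∑< m (λ i → f (a + i)) ≡ ∑< m f
  ∑<-rotate m f per zero    = refl
  ∑<-rotate m f per (suc a) = trans (+-cancelˡ-≡ (g 0) _ _ step) (∑<-rotate m f per a)
    where
    open ≡-Reasoning
    g : ℕ → ℕ
    g i = f (a + i)
    step : g 0 + ∑< m (λ i → f (suc a + i)) ≡ g 0 + ∑< m g
    step = begin
      g 0 + ∑< m (λ i → f (suc a + i))  ≡⟨ cong (g 0 +_) (∑<-cong m (λ i _ → cong f (sym (+-suc a i)))) ⟩
      ∑< (suc m) g                      ≡⟨ cong (λ n → ∑< n g) (+-comm 1 m) ⟩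
      ∑< (m + 1) g                      ≡⟨ ∑<-split m 1 g ⟩
      ∑< m g + (g (m + 0) + 0)          ≡⟨ cong (∑< m g +_) (+-identityʳ _) ⟩
      ∑< m g + g (m + 0)                ≡⟨ cong (λ n → ∑< m g + g n) (+-identityʳ m) ⟩
      ∑< m g + f (a + m)                ≡⟨ cong (∑< m g +_) (trans (per a) (cong f (sym (+-identityʳ a)))) ⟩
      ∑< m g + g 0                      ≡⟨ +-comm (∑< m g) (g 0) ⟩
      g 0 + ∑< m g                      ∎

  module _ (m : ℕ) {{_ : NonZero m}} where

    %-cong-+ʳ : ∀ {x y} d → x % m ≡ y % m → (x + d) % m ≡ (y + d) % m
    %-cong-+ʳ {x} {y} d eq = begin
      (x + d) % m              ≡⟨ %-distribˡ-+ x d m ⟩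
      (x % m + d % m) % m      ≡⟨ cong (λ r → (r + d % m) % m) eq ⟩
      (y % m + d % m) % m      ≡⟨ %-distribˡ-+ y d m ⟨
      (y + d) % m              ∎
      where open ≡-Reasoning

    %-fixed⇒∣ : ∀ x e → (x + e) % m ≡ x % m → m ∣ e
    %-fixed⇒∣ x e eq = ∣m+n∣m⇒∣n {m} {x / m * m} (divides ((x + e) / m) (+-cancelˡ-≡ (x % m) _ _ shifted)) (divides (x / m) refl)
      where
      open ≡-Reasoning
      shifted : x % m + (x / m * m + e) ≡ x % m + (x + e) / m * m
      shifted = begin
        x % m + (x / m * m + e)              ≡⟨ +-assoc (x % m) _ e ⟨
        x % m + x / m * m + e                ≡⟨ cong (_+ e) (m≡m%n+[m/n]*n x m) ⟨
        x + e                                ≡⟨ m≡m%n+[m/n]*n (x + e) m ⟩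
        (x + e) % m + (x + e) / m * m        ≡⟨ cong (_+ (x + e) / m * m) eq ⟩
        x % m + (x + e) / m * m              ∎

    no-small-period : ∀ x e → 0 < e → e < m → ¬ (x + e) % m ≡ x % m
    no-small-period x (suc e) _ e<m eq = <⇒≱ e<m (∣⇒≤ (%-fixed⇒∣ x (suc e) eq))

  -- In the application σ is the m-periodic lift of an independent set of the circulant graph, so
  -- differences in [k, 2k) are forbidden. Working on ℕ with windows avoids wrap-around until
  -- `cyclic-bound`.
  module Spread (k′ : ℕ) (σ : ℕ → Bool)
    (apart : ∀ i d → d < suc k′ → T (σ i) → ¬ T (σ (i + (suc k′ + d)))) where

    private
      k = suc k′
    open ≤-Reasoning

    count : ℕ → ℕ → ℕ
    count a L = ∑< L (λ i → ⟦ σ (a + i) ⟧)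

    apart′ : ∀ {i j} → T (σ i) → i + k ≤ j → j < i + (k + k) → ¬ T (σ j)
    apart′ {i} {j} σi lo hi σj = apart i (j ∸ (i + k)) d<k σi (subst (T ∘ σ) (sym j≡) σj)
      where
      split : i + k + (j ∸ (i + k)) ≡ j
      split = m+[n∸m]≡n lo
      j≡ : i + (k + (j ∸ (i + k))) ≡ j
      j≡ = trans (sym (+-assoc i k _)) split
      d<k : j ∸ (i + k) < k
      d<k = +-cancelˡ-< (i + k) _ _ (subst₂ _<_ (sym split) (sym (+-assoc i k k)) hi)

    -- The element a empties the k positions from a + k to a + 2k - 1. The others form k - 1 pairs a
    -- + 1 + i, a + 2k + i at the forbidden distance 2k - 1, and each pair contributes at most one
    -- element.
    window-from-one : ∀ a → T (σ a) → count a (k + (k + k′)) ≤ k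
    window-from-one a σa = begin
      count a (k + (k + k′))                                     ≡⟨ ∑<-split k (k + k′) (λ i → ⟦ σ (a + i) ⟧) ⟩
      count a k + ∑< (k + k′) (λ i → ⟦ σ (a + (k + i)) ⟧)        ≡⟨ cong (count a k +_) (∑<-split k k′ (λ i → ⟦ σ (a + (k + i)) ⟧)) ⟩
      count a k + (∑< k (λ i → ⟦ σ (a + (k + i)) ⟧) + late)      ≡⟨ cong (λ n → count a k + (n + late)) middle ⟩
      ⟦ σ (a + 0) ⟧ + early + late                               ≡⟨ +-assoc ⟦ σ (a + 0) ⟧ early late ⟩
      ⟦ σ (a + 0) ⟧ + (early + late)                             ≤⟨ +-mono-≤ (⟦⟧≤1 (σ (a + 0))) paired ⟩
      1 + k′                                                     ∎
      where
      early = ∑< k′ (λ i → ⟦ σ (a + suc i) ⟧)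
      late  = ∑< k′ (λ i → ⟦ σ (a + (k + (k + i))) ⟧)
      middle : ∑< k (λ i → ⟦ σ (a + (k + i)) ⟧) ≡ 0
      middle = trans (∑<-cong k (λ i i<k → ⟦⟧-false _ (apart a i i<k σa))) (trans (∑<-const k 0) (*-zeroʳ k))
      position : ∀ a i k′ → a + suc i + (suc k′ + k′) ≡ a + (suc k′ + (suc k′ + i))
      position = solve-∀
      paired : early + late ≤ k′
      paired = begin
        early + late      ≡⟨ ∑<-+ k′ _ _ ⟨
        ∑< k′ (λ i → ⟦ σ (a + suc i) ⟧ + ⟦ σ (a + (k + (k + i))) ⟧)
          ≤⟨ ∑<-mono k′ (λ i _ → ⟦⟧-disjoint _ _ (λ p q → apart (a + suc i) k′ ≤-refl p (subst (T ∘ σ) (sym (position a i k′)) q))) ⟩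
        ∑< k′ (λ _ → 1)   ≡⟨ trans (∑<-const k′ 1) (*-identityʳ k′) ⟩
        k′                ∎

    window : ∀ L a → L ≤ k + (k + k′) → count a L ≤ k
    window zero    a _ = z≤n
    window (suc L) a L≤ with T? (σ a)
    ... | yes σa = ≤-trans (∑<-monoˡ (λ i → ⟦ σ (a + i) ⟧) L≤) (window-from-one a σa)
    ... | no ¬σa = begin
      ⟦ σ (a + 0) ⟧ + ∑< L (λ i → ⟦ σ (a + suc i) ⟧)   ≡⟨ cong₂ _+_ (⟦⟧-false _ (λ p → ¬σa (subst (T ∘ σ) (+-identityʳ a) p))) (∑<-cong L (λ i _ → cong (⟦_⟧ ∘ σ) (+-suc a i))) ⟩
      count (suc a) L                                  ≤⟨ window L (suc a) (<⇒≤ L≤) ⟩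
      k                                                ∎

    last-one : ∀ x → T (σ x) → ∀ j → ∃ λ y → T (σ y) × x ≤ y × y ≤ x + j × (∀ z → y < z → z ≤ x + j → ¬ T (σ z))
    last-one x σx zero = x , σx , ≤-refl , m≤m+n x 0 , λ z x<z z≤ _ → <⇒≱ x<z (subst (z ≤_) (+-identityʳ x) z≤)
    last-one x σx (suc j) with T? (σ (x + suc j))
    ... | yes p = x + suc j , p , m≤m+n x (suc j) , ≤-refl , λ z lo hi _ → <⇒≱ lo hi
    ... | no ¬p with last-one x σx j
    ...   | y , σy , x≤y , y≤ , after = y , σy , x≤y , ≤-trans y≤ (+-monoʳ-≤ x (n≤1+n j)) , after′
      where
      after′ : ∀ z → y < z → z ≤ x + suc j → ¬ T (σ z)
      after′ z y<z z≤ with m≤n⇒m<n∨m≡n z≤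
      ... | inj₁ z<  = after z y<z (≤-pred (subst (suc z ≤_) (+-suc x j) z<))
      ... | inj₂ refl = ¬p

    -- Let y be the last element in [x, x + k - 1]. The 2k - 1 positions after y are empty: up to x
    -- + k - 1 by the choice of y, from x + k to x + 2k - 1 because of x, and beyond that because of
    -- y, since y ≤ x + k - 1 puts them at distance at least k from y.
    gap : ∀ x → T (σ x) → ∃ λ a → ∀ i → i < k + k′ → ¬ T (σ (a + i))
    gap x σx with last-one x σx k′
    ... | y , σy , x≤y , y≤ , after = suc y , clear
      where
      clear : ∀ i → i < k + k′ → ¬ T (σ (suc y + i))
      clear i i< with suc y + i ≤? x + k′
      ... | yes z≤ = after _ (s≤s (m≤m+n y i)) z≤
      ... | no z≰ with suc y + i <? x + (k + k)
      ...   | yes z< = apart′ σx (≤-trans (≤-reflexive (+-suc x k′)) (≰⇒> z≰)) z<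
      ...   | no z≮ = apart′ σy lo hi
        where
        lo : y + k ≤ suc y + i
        lo = begin
          y + k             ≤⟨ +-monoˡ-≤ k y≤ ⟩
          x + k′ + k        ≤⟨ +-monoˡ-≤ k (+-monoʳ-≤ x (n≤1+n k′)) ⟩
          x + k + k         ≡⟨ +-assoc x k k ⟩
          x + (k + k)       ≤⟨ ≮⇒≥ z≮ ⟩
          suc y + i         ∎
        hi : suc y + i < y + (k + k)
        hi = begin-strict
          suc y + i         ≡⟨ +-suc y i ⟨
          y + suc i         <⟨ +-monoʳ-< y (s≤s i<) ⟩
          y + suc (k + k′)  ≡⟨ cong (y +_) (+-suc k k′) ⟨
          y + (k + k)       ∎

    -- The period is started at an empty stretch of length 2k - 1; two windows of length 3k - 1 with
    -- at most k elements each cover the rest. This is where the bound 8k - 3 on the order of the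
    -- circulant graph comes from.
    cyclic-bound : ∀ m → m ≤ (k + k′) + ((k + (k + k′)) + (k + (k + k′))) →
      (∀ i → σ (i + m) ≡ σ i) → count 0 m ≤ k + k
    cyclic-bound m m≤ per with anyUpTo? (λ i → T? (σ i)) m
    ... | no none = ≤-trans (≤-reflexive (trans (∑<-cong m (λ i i<m → ⟦⟧-false _ (λ p → none (i , i<m , p)))) (trans (∑<-const m 0) (*-zeroʳ m)))) z≤n
    ... | yes (x , _ , σx) with gap x σx
    ...   | a , clear = begin
      count 0 m                                     ≡⟨ ∑<-rotate m (⟦_⟧ ∘ σ) (λ i → cong ⟦_⟧ (per i)) a ⟨
      count a m                                     ≤⟨ ∑<-monoˡ (λ i → ⟦ σ (a + i) ⟧) m≤ ⟩
      count a (g + (w + w))                         ≡⟨ ∑<-split g (w + w) (λ i → ⟦ σ (a + i) ⟧) ⟩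
      count a g + ∑< (w + w) (λ i → ⟦ σ (a + (g + i)) ⟧) ≡⟨ cong₂ _+_ empty (∑<-cong (w + w) (λ i _ → cong (⟦_⟧ ∘ σ) (sym (+-assoc a g i)))) ⟩
      count (a + g) (w + w)                         ≡⟨ ∑<-split w w (λ i → ⟦ σ (a + g + i) ⟧) ⟩
      count (a + g) w + ∑< w (λ i → ⟦ σ (a + g + (w + i)) ⟧) ≡⟨ cong (count (a + g) w +_) (∑<-cong w (λ i _ → cong (⟦_⟧ ∘ σ) (sym (+-assoc (a + g) w i)))) ⟩
      count (a + g) w + count (a + g + w) w         ≤⟨ +-mono-≤ (window w (a + g) ≤-refl) (window w (a + g + w) ≤-refl) ⟩
      k + k                                         ∎
      where
      g = k + k′
      w = k + (k + k′)
      empty : count a g ≡ 0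
      empty = trans (∑<-cong g (λ i i<g → ⟦⟧-false _ (clear i i<g))) (trans (∑<-const g 0) (*-zeroʳ g))

  module Circulant (k′ m : ℕ) {{_ : NonZero m}}
    (lower : 6 * suc k′ ≤ m) (upper : m + 3 ≤ 8 * suc k′) where

    private
      k = suc k′

      -- Orienting each edge in the direction of a step in [k, 2k) leaves two kinds of triangle to
      -- exclude, cyclic and transitive ones.
      Arc : ℕ → ℕ → Set
      Arc x y = ∃ λ d → d < k × (x + (k + d)) % m ≡ y % m

      arc? : ∀ x y → Dec (Arc x y)
      arc? x y = anyUpTo? (λ d → (x + (k + d)) % m ℕₚ.≟ y % m) k

      E : ℕ → ℕ → Bool
      E x y = ⌊ arc? x y ⌋ ∨ ⌊ arc? y x ⌋

      arc⇒E : ∀ {x y} → Arc x y → T (E x y)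
      arc⇒E {x} {y} p = Equivalence.from (T-∨ {⌊ arc? x y ⌋}) (inj₁ (fromWitness p))

      arc⇒Eˢ : ∀ {x y} → Arc y x → T (E x y)
      arc⇒Eˢ {x} {y} p = Equivalence.from (T-∨ {⌊ arc? x y ⌋}) (inj₂ (fromWitness p))

      span< : ∀ {d d′ d″} → d < k → d′ < k → d″ < k → (k + d) + ((k + d′) + (k + d″)) < m
      span< {d} {d′} {d″} p q r = begin-strict
        (k + d) + ((k + d′) + (k + d″))   <⟨ +-mono-< (+-monoʳ-< k p) (+-mono-< (+-monoʳ-< k q) (+-monoʳ-< k r)) ⟩
        (k + k) + ((k + k) + (k + k))     ≡⟨ six k ⟩
        6 * k                             ≤⟨ lower ⟩
        m                                 ∎
        where
        open ≤-Reasoning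
        six : ∀ k → (k + k) + ((k + k) + (k + k)) ≡ 6 * k
        six = solve-∀

      compose : ∀ {x y z a b} → (x + a) % m ≡ y % m → (y + b) % m ≡ z % m → (x + (a + b)) % m ≡ z % m
      compose {x} {y} {z} {a} {b} p q =
        trans (cong (_% m) (sym (+-assoc x a b))) (trans (%-cong-+ʳ m {x + a} {y} b p) q)

      -- Three steps below 2k add up to a positive number below 6k ≤ m, so they cannot return to the
      -- start. This is the use of `lower`.
      no-cyclic : ∀ {x y z} → Arc x y → Arc y z → ¬ Arc z x
      no-cyclic {x} {y} {z} (d , d< , p) (e , e< , q) (f , f< , r) =
        no-small-period m x _ (s≤s z≤n) (span< d< e< f<) (compose {x} {y} {x} {k + d} p (compose {y} {z} {x} {k + e} q r))

      no-transitive : ∀ {x y z} → Arc x y → Arc y z → ¬ Arc x z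
      no-transitive {x} {y} {z} (d , d< , p) (e , e< , q) (f , f< , r) =
        no-small-period m (x + (k + f)) t (≤-trans (s≤s z≤n) (m≤n+m (suc d) (k′ ∸ f + e)))
          (≤-trans (s≤s (m≤n+m t (k + f + (k + f)))) (≤-trans (≤-reflexive (cong suc (trans (+-assoc (k + f) (k + f) t) (cong ((k + f) +_) t-eq)))) (span< f< d< e<)))
          (trans (cong (_% m) (trans (+-assoc x (k + f) t) (cong (x +_) t-eq))) (trans (compose {x} {y} {z} {k + d} p q) (sym r)))
        where
        -- The surplus of two steps, at least 2k in total, over a single step, at most 2k - 1. In
        -- this form it is visibly positive, and `t-eq` identifies it without subtracting sums.
        t = k′ ∸ f + e + suc d
        rearrange : ∀ k′ f g e d → g + f ≡ k′ → suc k′ + f + (g + e + suc d) ≡ (suc k′ + d) + (suc k′ + e)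
        rearrange k′ f g e d refl = solved f g e d
          where
          solved : ∀ f g e d → suc (g + f) + f + (g + e + suc d) ≡ (suc (g + f) + d) + (suc (g + f) + e)
          solved = solve-∀
        t-eq : (k + f) + t ≡ (k + d) + (k + e)
        t-eq = rearrange k′ f (k′ ∸ f) e d (m∸n+n≡m (≤-pred f<))

      triangle-free : ∀ x y z → T (E x y) → T (E y z) → ¬ T (E x z)
      triangle-free x y z p q r
        with Equivalence.to (T-∨ {⌊ arc? x y ⌋}) p | Equivalence.to (T-∨ {⌊ arc? y z ⌋}) q | Equivalence.to (T-∨ {⌊ arc? x z ⌋}) r
      ... | inj₁ a | inj₁ b | inj₁ c = no-transitive {x} {y} {z} (toWitness a) (toWitness b) (toWitness c)
      ... | inj₁ a | inj₁ b | inj₂ c = no-cyclic {x} {y} {z} (toWitness a) (toWitness b) (toWitness c)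
      ... | inj₁ a | inj₂ b | inj₁ c = no-transitive {x} {z} {y} (toWitness c) (toWitness b) (toWitness a)
      ... | inj₁ a | inj₂ b | inj₂ c = no-transitive {z} {x} {y} (toWitness c) (toWitness a) (toWitness b)
      ... | inj₂ a | inj₁ b | inj₁ c = no-transitive {y} {x} {z} (toWitness a) (toWitness c) (toWitness b)
      ... | inj₂ a | inj₁ b | inj₂ c = no-transitive {y} {z} {x} (toWitness b) (toWitness c) (toWitness a)
      ... | inj₂ a | inj₂ b | inj₁ c = no-cyclic {x} {z} {y} (toWitness c) (toWitness b) (toWitness a)
      ... | inj₂ a | inj₂ b | inj₂ c = no-transitive {z} {y} {x} (toWitness b) (toWitness a) (toWitness c)

      independence : ∀ s → Independent E s → ∑ (upTo m) (λ u → ⟦ s u ⟧) ≤ 2 * k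
      independence s s-ind = begin
        ∑ (upTo m) (λ u → ⟦ s u ⟧)         ≡⟨ ∑-applyUpTo m (λ i → i) (⟦_⟧ ∘ s) ⟩
        ∑< m (λ i → ⟦ s i ⟧)               ≡⟨ ∑<-cong m (λ i i<m → cong (⟦_⟧ ∘ s) (sym (m<n⇒m%n≡m i<m))) ⟩
        ∑< m (λ i → ⟦ s (i % m) ⟧)         ≤⟨ Spread.cyclic-bound k′ (λ i → s (i % m)) apart m m≤ (λ i → cong s ([m+n]%n≡m%n i m)) ⟩
        k + k                              ≡⟨ cong (k +_) (+-identityʳ k) ⟨
        2 * k                              ∎
        where
        open ≤-Reasoning
        apart : ∀ i d → d < k → T (s (i % m)) → ¬ T (s ((i + (k + d)) % m))
        apart i d d<k p q = s-ind _ _ p q (arc⇒E (d , d<k ,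
          trans (%-cong-+ʳ m {i % m} {i} (k + d) (m%n%n≡m%n i m)) (sym (m%n%n≡m%n (i + (k + d)) m))))
        total : ∀ k′ → (suc k′ + k′) + ((suc k′ + (suc k′ + k′)) + (suc k′ + (suc k′ + k′))) + 3 ≡ 8 * suc k′
        total = solve-∀
        m≤ : m ≤ (k + k′) + ((k + (k + k′)) + (k + (k + k′)))
        m≤ = +-cancelʳ-≤ 3 _ _ (≤-trans upper (≤-reflexive (sym (total k′))))

      -- Summation is moved to the period starting at x + k. The out-neighbours of x then fill the
      -- first k positions and the in-neighbours a later block of k positions; 4k ≤ m keeps the
      -- blocks apart.
      degree : ∀ x → 2 * k ≤ ∑ (upTo m) (λ y → ⟦ E x y ⟧)
      degree x = begin
        2 * k                                                  ≡⟨ cong (k +_) (+-identityʳ k) ⟩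
        k + k                                                  ≡⟨ cong₂ _+_ forward backward ⟨
        ∑< k F + ∑< k (λ i → F (k + (r + i)))                  ≤⟨ +-monoʳ-≤ (∑< k F) tail ⟩
        ∑< k F + ∑< (r + (k + (k + k′))) (λ i → F (k + i))     ≡⟨ ∑<-split k _ F ⟨
        ∑< (k + (r + (k + (k + k′)))) F                        ≡⟨ cong (λ n → ∑< n F) m≡ ⟩
        ∑< m F                                                 ≡⟨ ∑<-rotate m (λ y → ⟦ E x y ⟧) (λ y → cong ⟦_⟧ (E-periodic y)) (x + k) ⟩
        ∑< m (λ y → ⟦ E x y ⟧)                                 ≡⟨ ∑-applyUpTo m (λ i → i) (λ y → ⟦ E x y ⟧) ⟨
        ∑ (upTo m) (λ y → ⟦ E x y ⟧)                           ∎
        where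
        open ≤-Reasoning
        F : ℕ → ℕ
        F i = ⟦ E x (x + k + i) ⟧
        -- Chosen so that offset k + r from x + k is x + m - (2k - 1), the first in-neighbour of x
        -- in this period.
        r = suc (m ∸ 4 * k)
        4k≤m : 4 * k ≤ m
        4k≤m = ≤-trans (*-monoˡ-≤ k (s≤s (s≤s (s≤s (s≤s (z≤n {2})))))) lower
        m≡ : k + (r + (k + (k + k′))) ≡ m
        m≡ = trans (collect k′ (m ∸ 4 * k)) (m+[n∸m]≡n 4k≤m)
          where
          collect : ∀ k′ g → suc k′ + (suc g + (suc k′ + (suc k′ + k′))) ≡ 4 * suc k′ + g
          collect = solve-∀
        E-periodic : ∀ y → E x (y + m) ≡ E x y
        E-periodic y = cong₂ _∨_ (does-cong (arc? x (y + m)) (arc? x y)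
            (λ (d , d< , p) → d , d< , trans p ([m+n]%n≡m%n y m))
            (λ (d , d< , p) → d , d< , trans p (sym ([m+n]%n≡m%n y m))))
          (does-cong (arc? (y + m) x) (arc? y x)
            (λ (d , d< , p) → d , d< , trans (sym (%-cong-+ʳ m {y + m} {y} (k + d) ([m+n]%n≡m%n y m))) p)
            (λ (d , d< , p) → d , d< , trans (%-cong-+ʳ m {y + m} {y} (k + d) ([m+n]%n≡m%n y m)) p))
          where
          does-cong : ∀ {P Q : Set} (p? : Dec P) (q? : Dec Q) → (P → Q) → (Q → P) → ⌊ p? ⌋ ≡ ⌊ q? ⌋
          does-cong (yes p) (yes q) f g = refl
          does-cong (yes p) (no ¬q) f g = ⊥-elim (¬q (f p))
          does-cong (no ¬p) (yes q) f g = ⊥-elim (¬p (g q))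
          does-cong (no ¬p) (no ¬q) f g = refl
        ones : ∀ n {f : ℕ → ℕ} → (∀ i → i < n → f i ≡ 1) → ∑< n f ≡ n
        ones n h = trans (∑<-cong n h) (trans (∑<-const n 1) (*-identityʳ n))
        forward : ∑< k F ≡ k
        forward = ones k (λ i i<k → ⟦⟧-true _ (arc⇒E {x} (i , i<k , cong (_% m) (sym (+-assoc x k i)))))
        backward : ∑< k (λ i → F (k + (r + i))) ≡ k
        backward = ones k (λ i i<k → ⟦⟧-true _ (arc⇒Eˢ {x} (k′ ∸ i , s≤s (m∸n≤m k′ i) ,
            trans (cong (_% m) (round-trip i (≤-pred i<k))) ([m+n]%n≡m%n x m))))
          where
          round-trip : ∀ i → i ≤ k′ → x + k + (k + (r + i)) + (k + (k′ ∸ i)) ≡ x + m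
          round-trip i i≤k′ = trans (regroup x k (r + i) (k′ ∸ i)) (trans (cong (λ n → x + (k + (n + (k + k)))) (+-assoc r i (k′ ∸ i)))
              (trans (cong (λ n → x + (k + (r + n + (k + k)))) (m+[n∸m]≡n i≤k′)) (cong (x +_) (trans (final k r k′) m≡))))
            where
            regroup : ∀ x k ri g → x + k + (k + ri) + (k + g) ≡ x + (k + (ri + g + (k + k)))
            regroup = solve-∀
            final : ∀ k r k′ → k + (r + k′ + (k + k)) ≡ k + (r + (k + (k + k′)))
            final = solve-∀
        tail : ∑< k (λ i → F (k + (r + i))) ≤ ∑< (r + (k + (k + k′))) (λ i → F (k + i))
        tail = begin
          ∑< k (λ i → F (k + (r + i)))                ≤⟨ ∑<-monoˡ (λ i → F (k + (r + i))) (m≤m+n k (k + k′)) ⟩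
          ∑< (k + (k + k′)) (λ i → F (k + (r + i)))   ≤⟨ m≤n+m _ (∑< r (λ i → F (k + i))) ⟩
          _                                           ≡⟨ ∑<-split r (k + (k + k′)) (λ i → F (k + i)) ⟨
          ∑< (r + (k + (k + k′))) (λ i → F (k + i))   ∎

    -- The vertex type is all of ℕ, read modulo m through `E`; the list holds each residue once.
    circulant : Balanced
    circulant = record
      { V = ℕ ; _≟_ = ℕₚ._≟_ ; E = E ; E-sym = λ x y → ∨-comm ⌊ arc? x y ⌋ ⌊ arc? y x ⌋
      ; triangle-free = triangle-free ; verts = upTo m ; D = 2 * k ; D>0 = s≤s z≤n
      ; D≤M = ≤-trans (≤-trans (*-monoˡ-≤ k (s≤s (s≤s (z≤n {4})))) lower) (≤-reflexive (sym (length-upTo m)))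
      ; degree = degree ; independence = independence }

    M-circulant : Balanced.M circulant ≡ m
    M-circulant = length-upTo m

  -- Approximating a given ratio

  -- A discrete intermediate value theorem. It serves twice below: to select the number of Mycielski
  -- steps, and to select the circulant graph they start from.
  switch : ∀ {P : ℕ → Set} → Decidable P → ∀ n → P n → P 0 ⊎ (∃ λ i → i < n × ¬ P i × P (suc i))
  switch P? zero    p = inj₁ p
  switch P? (suc n) p with P? n
  ... | no ¬pn = inj₂ (n , ≤-refl , ¬pn , p)
  ... | yes pn with switch P? n pn
  ...   | inj₁ p0              = inj₁ p0
  ...   | inj₂ (i , i<n , q , r) = inj₂ (i , m<n⇒m<1+n i<n , q , r)

  -- (M , D) stands for the ratio M / D.
  Ratio : Set
  Ratio = ℕ × ℕ

  _≼_ : Ratio → Ratio → Set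
  (M₁ , D₁) ≼ (M₂ , D₂) = M₁ * D₂ ≤ M₂ * D₁

  -- The cross-multiplied form of M₂/D₂ ≤ M₁/D₁ + 1/h.
  Within : ℕ → Ratio → Ratio → Set
  Within h (M₁ , D₁) (M₂ , D₂) = M₂ * D₁ * h ≤ M₁ * D₂ * h + D₁ * D₂

  AtLeastOne : Ratio → Set
  AtLeastOne (M , D) = 0 < D × D ≤ M

  -- x ↦ x + 1/x
  φ : Ratio → Ratio
  φ (M , D) = M * M + D * D , M * D

  φ-AtLeastOne : ∀ r → AtLeastOne r → AtLeastOne (φ r)
  φ-AtLeastOne (M , D) (D>0 , D≤M) =
    *-mono-≤ (≤-trans D>0 D≤M) D>0 , ≤-trans (*-monoʳ-≤ M D≤M) (m≤m+n (M * M) (D * D))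

  -- φ(y) - φ(x) = (y - x)(1 - 1/(xy)), and xy ≥ 1 appears here as D₁·D₂ ≤ M₁·M₂.
  φ-mono : ∀ r s → AtLeastOne r → AtLeastOne s → r ≼ s → φ r ≼ φ s
  φ-mono (M₁ , D₁) (M₂ , D₂) (_ , D₁≤M₁) (_ , D₂≤M₂) r≼s = begin
    (M₁ * M₁ + D₁ * D₁) * (M₂ * D₂)                        ≡⟨ expand₁ M₁ D₁ M₂ D₂ ⟩
    M₁ * M₂ * a + D₁ * D₂ * b                              ≡⟨ cong (λ n → M₁ * M₂ * a + D₁ * D₂ * n) b≡ ⟩
    M₁ * M₂ * a + D₁ * D₂ * (a + t)                        ≡⟨ regroup (M₁ * M₂) (D₁ * D₂) a t ⟩
    M₁ * M₂ * a + D₁ * D₂ * a + D₁ * D₂ * t                ≤⟨ +-monoʳ-≤ (M₁ * M₂ * a + D₁ * D₂ * a) (*-monoˡ-≤ t (*-mono-≤ D₁≤M₁ D₂≤M₂)) ⟩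
    M₁ * M₂ * a + D₁ * D₂ * a + M₁ * M₂ * t                ≡⟨ regroup′ (M₁ * M₂) (D₁ * D₂) a t ⟩
    M₁ * M₂ * (a + t) + D₁ * D₂ * a                        ≡⟨ cong (λ n → M₁ * M₂ * n + D₁ * D₂ * a) b≡ ⟨
    M₁ * M₂ * b + D₁ * D₂ * a                              ≡⟨ expand₂ M₁ D₁ M₂ D₂ ⟩
    (M₂ * M₂ + D₂ * D₂) * (M₁ * D₁)                        ∎
    where
    open ≤-Reasoning
    a = M₁ * D₂
    b = M₂ * D₁
    t = b ∸ a
    b≡ : b ≡ a + t
    b≡ = sym (m+[n∸m]≡n r≼s)
    expand₁ : ∀ M₁ D₁ M₂ D₂ → (M₁ * M₁ + D₁ * D₁) * (M₂ * D₂) ≡ M₁ * M₂ * (M₁ * D₂) + D₁ * D₂ * (M₂ * D₁)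
    expand₁ = solve-∀
    expand₂ : ∀ M₁ D₁ M₂ D₂ → M₁ * M₂ * (M₂ * D₁) + D₁ * D₂ * (M₁ * D₂) ≡ (M₂ * M₂ + D₂ * D₂) * (M₁ * D₁)
    expand₂ = solve-∀
    regroup : ∀ m d a t → m * a + d * (a + t) ≡ m * a + d * a + d * t
    regroup = solve-∀
    regroup′ : ∀ m d a t → m * a + d * a + m * t ≡ m * (a + t) + d * a
    regroup′ = solve-∀

  -- Along r ≼ s the summand 1/x only decreases, so the gap between the images is at most the gap of
  -- the summands x.
  φ-Within : ∀ h r s → r ≼ s → Within h r s → Within h (φ r) (φ s)
  φ-Within h (M₁ , D₁) (M₂ , D₂) r≼s near = begin
    (M₂ * M₂ + D₂ * D₂) * (M₁ * D₁) * h                    ≡⟨ expand₁ M₁ D₁ M₂ D₂ h ⟩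
    M₁ * M₂ * (b * h) + D₁ * D₂ * h * a                    ≤⟨ +-mono-≤ (*-monoʳ-≤ (M₁ * M₂) near) (*-monoʳ-≤ (D₁ * D₂ * h) r≼s) ⟩
    M₁ * M₂ * (a * h + D₁ * D₂) + D₁ * D₂ * h * b          ≡⟨ expand₂ M₁ D₁ M₂ D₂ h ⟩
    (M₁ * M₁ + D₁ * D₁) * (M₂ * D₂) * h + M₁ * D₁ * (M₂ * D₂) ∎
    where
    open ≤-Reasoning
    a = M₁ * D₂
    b = M₂ * D₁
    expand₁ : ∀ M₁ D₁ M₂ D₂ h → (M₂ * M₂ + D₂ * D₂) * (M₁ * D₁) * h ≡ M₁ * M₂ * (M₂ * D₁ * h) + D₁ * D₂ * h * (M₁ * D₂)
    expand₁ = solve-∀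
    expand₂ : ∀ M₁ D₁ M₂ D₂ h → M₁ * M₂ * (M₁ * D₂ * h + D₁ * D₂) + D₁ * D₂ * h * (M₂ * D₁) ≡ (M₁ * M₁ + D₁ * D₁) * (M₂ * D₂) * h + M₁ * D₁ * (M₂ * D₂)
    expand₂ = solve-∀

  φ^ : ℕ → Ratio → Ratio
  φ^ zero    r = r
  φ^ (suc j) r = φ (φ^ j r)

  φ^-AtLeastOne : ∀ j {r} → AtLeastOne r → AtLeastOne (φ^ j r)
  φ^-AtLeastOne zero    p = p
  φ^-AtLeastOne (suc j) p = φ-AtLeastOne _ (φ^-AtLeastOne j p)

  φ^-mono : ∀ j {r s} → AtLeastOne r → AtLeastOne s → r ≼ s → φ^ j r ≼ φ^ j s
  φ^-mono zero    _ _ r≼s = r≼s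
  φ^-mono (suc j) {r} {s} p q r≼s = φ-mono (φ^ j r) (φ^ j s) (φ^-AtLeastOne j p) (φ^-AtLeastOne j q) (φ^-mono j p q r≼s)

  φ^-Within : ∀ h j {r s} → AtLeastOne r → AtLeastOne s → r ≼ s → Within h r s → Within h (φ^ j r) (φ^ j s)
  φ^-Within h zero    _ _ _   near = near
  φ^-Within h (suc j) {r} {s} p q r≼s near = φ-Within h (φ^ j r) (φ^ j s) (φ^-mono j p q r≼s) (φ^-Within h j p q r≼s near)

  -- Lets the comparison of φ(3) with the last starting ratio be carried through j iterations by
  -- `φ^-mono`.
  φ^-φ : ∀ j r → φ^ j (φ r) ≡ φ (φ^ j r)
  φ^-φ zero    r = refl
  φ^-φ (suc j) r = cong φ (φ^-φ j r)

  -- (x + 1/x)² ≥ x² + 2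
  φ^-grows : ∀ j r → let (M , D) = φ^ j r in j * (D * D) ≤ M * M
  φ^-grows zero    r = z≤n
  φ^-grows (suc j) r = begin
    suc j * (M * D * (M * D))                              ≡⟨ expand₁ j M D ⟩
    M * M * (D * D) + M * M * (j * (D * D))                ≤⟨ +-monoʳ-≤ (M * M * (D * D)) (*-monoʳ-≤ (M * M) (φ^-grows j r)) ⟩
    M * M * (D * D) + M * M * (M * M)                      ≤⟨ m≤m+n _ (M * M * (D * D) + D * D * (D * D)) ⟩
    M * M * (D * D) + M * M * (M * M) + (M * M * (D * D) + D * D * (D * D)) ≡⟨ expand₂ M D ⟩
    (M * M + D * D) * (M * M + D * D)                      ∎
    where
    open ≤-Reasoning
    M = proj₁ (φ^ j r)
    D = proj₂ (φ^ j r)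
    expand₁ : ∀ j M D → suc j * (M * D * (M * D)) ≡ M * M * (D * D) + M * M * (j * (D * D))
    expand₁ = solve-∀
    expand₂ : ∀ M D → M * M * (D * D) + M * M * (M * M) + (M * M * (D * D) + D * D * (D * D)) ≡ (M * M + D * D) * (M * M + D * D)
    expand₂ = solve-∀

  Realises : Ratio → Balanced → Set
  Realises (M , D) G = Balanced.M G ≡ M × Balanced.D G ≡ D

  φ^-realised : ∀ j r → (Σ Balanced (Realises r)) → Σ Balanced (Realises (φ^ j r))
  φ^-realised zero    r real = real
  φ^-realised (suc j) r real with φ^-realised j r real
  ... | G , M≡ , D≡ = Mycielski.cone G ,
    trans (Mycielski.M-cone G) (cong₂ _+_ (cong₂ _*_ M≡ M≡) (cong₂ _*_ D≡ D≡)) , cong₂ _*_ M≡ D≡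

  module Approximation (p q h : ℕ) (p>0 : 0 < p) (3p≤q : 3 * p ≤ q) where
    open ≤-Reasoning

    private
      -- Neighbouring starting ratios differ by 1/(2k), which must be at most 1/h, and `ranges-meet`
      -- requires k ≥ 3; k = h + 3 meets both demands.
      k′ = h + 2
      k = suc k′
      -- 6k + N = 8k - 3, the largest order that `Circulant` admits.
      N = 2 * h + 3

      initial : ℕ → Ratio
      initial i = 6 * k + i , 2 * k

      initial-AtLeastOne : ∀ i → AtLeastOne (initial i)
      initial-AtLeastOne i = s≤s z≤n , ≤-trans (*-monoˡ-≤ k (s≤s (s≤s (z≤n {4})))) (m≤m+n (6 * k) i)

      initial-mono : ∀ i → initial i ≼ initial (suc i)
      initial-mono i = *-monoˡ-≤ (2 * k) (+-monoʳ-≤ (6 * k) (n≤1+n i))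

      initial-Within : ∀ i → Within h (initial i) (initial (suc i))
      initial-Within i = begin
        (6 * k + suc i) * (2 * k) * h                      ≡⟨ expand (6 * k) i (2 * k) h ⟩
        (6 * k + i) * (2 * k) * h + 2 * k * h              ≤⟨ +-monoʳ-≤ ((6 * k + i) * (2 * k) * h) (*-monoʳ-≤ (2 * k) h≤2k) ⟩
        (6 * k + i) * (2 * k) * h + 2 * k * (2 * k)        ∎
        where
        expand : ∀ a i d h → (a + suc i) * d * h ≡ (a + i) * d * h + d * h
        expand = solve-∀
        h≤2k : h ≤ 2 * k
        h≤2k = ≤-trans (≤-trans (m≤m+n h 2) (n≤1+n k′)) (m≤m+n k _)

      -- φ(3) = 10/3 lies below the last starting ratio (8k − 3)/(2k), as k ≥ 3.
      ranges-meet : φ (initial 0) ≼ initial N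
      ranges-meet = ≤-trans (m≤m+n _ (16 * h * h * h + 108 * h * h + 216 * h + 108)) (≤-reflexive (expand h))
        where
        expand : ∀ h → ((6 * suc (h + 2) + 0) * (6 * suc (h + 2) + 0) + 2 * suc (h + 2) * (2 * suc (h + 2))) * (2 * suc (h + 2)) + (16 * h * h * h + 108 * h * h + 216 * h + 108)
                   ≡ (6 * suc (h + 2) + (2 * h + 3)) * ((6 * suc (h + 2) + 0) * (2 * suc (h + 2)))
        expand = solve-∀

      initial-realised : ∀ i → i ≤ N → Σ Balanced (Realises (initial i))
      initial-realised i i≤N = circulant , M-circulant , refl
        where
        upper : 6 * k + i + 3 ≤ 8 * k
        upper = ≤-trans (+-monoˡ-≤ 3 (+-monoʳ-≤ (6 * k) i≤N)) (≤-reflexive (expand h))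
          where
          expand : ∀ h → 6 * suc (h + 2) + (2 * h + 3) + 3 ≡ 8 * suc (h + 2)
          expand = solve-∀
        open Circulant k′ (6 * k + i) (m≤m+n (6 * k) i) upper

      -- The target ratio is q/p, that is 1/c.
      Exceeds : Ratio → Set
      Exceeds (M , D) = D * q < M * p

      exceeds? : Decidable Exceeds
      exceeds? (M , D) = D * q <? M * p

      ¬exceeds-≼ : ∀ r s → AtLeastOne s → r ≼ s → ¬ Exceeds s → ¬ Exceeds r
      ¬exceeds-≼ (M₁ , D₁) (M₂ , D₂) (D₂>0 , _) r≼s ¬s = ≤⇒≯ (*-cancelʳ-≤ _ _ D₂ {{>-nonZero D₂>0}} (begin
        M₁ * p * D₂        ≡⟨ swap M₁ p D₂ ⟩
        M₁ * D₂ * p        ≤⟨ *-monoˡ-≤ p r≼s ⟩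
        M₂ * D₁ * p        ≡⟨ swap′ M₂ D₁ p ⟩
        D₁ * (M₂ * p)      ≤⟨ *-monoʳ-≤ D₁ (≮⇒≥ ¬s) ⟩
        D₁ * (D₂ * q)      ≡⟨ swap″ D₁ D₂ q ⟩
        D₁ * q * D₂        ∎))
        where
        swap : ∀ a b c → a * b * c ≡ a * c * b
        swap = solve-∀
        swap′ : ∀ a b c → a * b * c ≡ b * (a * c)
        swap′ = solve-∀
        swap″ : ∀ a b c → a * (b * c) ≡ a * c * b
        swap″ = solve-∀

      -- After q² + 1 iterations the square of the ratio is at least q² + 1, so the ratio exceeds q,
      -- hence also q/p.
      eventually : Exceeds (φ^ (suc (q * q)) (initial N))
      eventually = <-≤-trans (≰⇒> M≰qD) (m≤m*n M p {{>-nonZero p>0}})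
        where
        r = φ^ (suc (q * q)) (initial N)
        M = proj₁ r
        D = proj₂ r
        D>0 : 0 < D
        D>0 = proj₁ (φ^-AtLeastOne (suc (q * q)) (initial-AtLeastOne N))
        M≰qD : ¬ M ≤ D * q
        M≰qD M≤ = <⇒≱ (m<n+m (q * q * (D * D)) (*-mono-≤ D>0 D>0)) (begin
          D * D + q * q * (D * D)     ≤⟨ φ^-grows (suc (q * q)) (initial N) ⟩
          M * M                       ≤⟨ *-mono-≤ M≤ M≤ ⟩
          D * q * (D * q)             ≡⟨ square D q ⟩
          q * q * (D * D)             ∎)
          where
          square : ∀ D q → D * q * (D * q) ≡ q * q * (D * D)
          square = solve-∀

      -- At a level where the last starting ratio begins to exceed the target, the first one does
      -- not: at level 0 because 3 ≤ q/p, and at level j + 1 because its image lies below that of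
      -- the last starting ratio at level j. The images at the level found therefore straddle the
      -- target.
      level : ∃ λ j → ¬ Exceeds (φ^ j (initial 0)) × Exceeds (φ^ j (initial N))
      level = from-switch (switch (λ j → exceeds? (φ^ j (initial N))) (suc (q * q)) eventually)
        where
        below-target : ¬ Exceeds (initial 0)
        below-target = ≤⇒≯ (≤-trans (≤-reflexive (three k p)) (*-monoʳ-≤ (2 * k) 3p≤q))
          where
          three : ∀ k p → (6 * k + 0) * p ≡ 2 * k * (3 * p)
          three = solve-∀
        below : ∀ j → φ (φ^ j (initial 0)) ≼ φ^ j (initial N)
        below j = subst (_≼ φ^ j (initial N)) (φ^-φ j (initial 0))
          (φ^-mono j (φ-AtLeastOne _ (initial-AtLeastOne 0)) (initial-AtLeastOne N) ranges-meet)
        from-switch : Exceeds (initial N) ⊎ (∃ λ j → j < suc (q * q) × ¬ Exceeds (φ^ j (initial N)) × Exceeds (φ^ (suc j) (initial N))) →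
          ∃ λ j → ¬ Exceeds (φ^ j (initial 0)) × Exceeds (φ^ j (initial N))
        from-switch (inj₁ ex)               = 0 , below-target , ex
        from-switch (inj₂ (j , _ , ¬ex , ex)) = suc j ,
          ¬exceeds-≼ (φ^ (suc j) (initial 0)) (φ^ j (initial N)) (φ^-AtLeastOne j (initial-AtLeastOne N)) (below j) ¬ex , ex

      near-target : ∀ r s → AtLeastOne r → ¬ Exceeds r → Within h r s → proj₁ s * p * h ≤ proj₂ s * q * h + proj₂ s * p
      near-target (M₁ , D₁) (M₂ , D₂) (D₁>0 , _) ¬ex near = *-cancelˡ-≤ D₁ {{>-nonZero D₁>0}} (begin
        D₁ * (M₂ * p * h)                    ≡⟨ expand₁ D₁ M₂ p h ⟩
        M₂ * D₁ * h * p                      ≤⟨ *-monoˡ-≤ p near ⟩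
        (M₁ * D₂ * h + D₁ * D₂) * p          ≡⟨ expand₂ M₁ D₁ D₂ h p ⟩
        M₁ * p * (D₂ * h) + D₁ * (D₂ * p)    ≤⟨ +-monoˡ-≤ (D₁ * (D₂ * p)) (*-monoˡ-≤ (D₂ * h) (≮⇒≥ ¬ex)) ⟩
        D₁ * q * (D₂ * h) + D₁ * (D₂ * p)    ≡⟨ expand₃ D₁ D₂ q h p ⟩
        D₁ * (D₂ * q * h + D₂ * p)           ∎)
        where
        expand₁ : ∀ D₁ M₂ p h → D₁ * (M₂ * p * h) ≡ M₂ * D₁ * h * p
        expand₁ = solve-∀
        expand₂ : ∀ M₁ D₁ D₂ h p → (M₁ * D₂ * h + D₁ * D₂) * p ≡ M₁ * p * (D₂ * h) + D₁ * (D₂ * p)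
        expand₂ = solve-∀
        expand₃ : ∀ D₁ D₂ q h p → D₁ * q * (D₂ * h) + D₁ * (D₂ * p) ≡ D₁ * (D₂ * q * h + D₂ * p)
        expand₃ = solve-∀

    -- The two conditions read q/p < M/D ≤ q/p + 1/h. Between two neighbouring starting ratios the
    -- images pass the target; the upper image is taken, and it is within 1/h of the lower one
    -- because φ does not enlarge gaps.
    balanced-near : Σ Balanced λ G → let open Balanced G in
      D * q < M * p × M * p * h ≤ D * q * h + D * p
    balanced-near = from-level level
      where
      Target : Balanced → Set
      Target G = let open Balanced G in D * q < M * p × M * p * h ≤ D * q * h + D * p
      transport : ∀ {s} → Exceeds s → proj₁ s * p * h ≤ proj₂ s * q * h + proj₂ s * p →
        Σ Balanced (Realises s) → Σ Balanced Target
      transport ex near (G , refl , refl) = G , ex , near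
      from-switch : ∀ j → ¬ Exceeds (φ^ j (initial 0)) →
        Exceeds (φ^ j (initial 0)) ⊎ (∃ λ i → i < N × ¬ Exceeds (φ^ j (initial i)) × Exceeds (φ^ j (initial (suc i)))) →
        Σ Balanced Target
      from-switch j ¬ex₀ (inj₁ ex₀) = ⊥-elim (¬ex₀ ex₀)
      from-switch j _    (inj₂ (i , i<N , ¬ex , ex)) = transport ex
        (near-target (φ^ j (initial i)) (φ^ j (initial (suc i))) (φ^-AtLeastOne j (initial-AtLeastOne i)) ¬ex
          (φ^-Within h j (initial-AtLeastOne i) (initial-AtLeastOne (suc i)) (initial-mono i) (initial-Within i)))
        (φ^-realised j (initial (suc i)) (initial-realised (suc i) i<N))
      from-level : (∃ λ j → ¬ Exceeds (φ^ j (initial 0)) × Exceeds (φ^ j (initial N))) → Σ Balanced Target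
      from-level (j , ¬ex₀ , exN) = from-switch j ¬ex₀ (switch (λ i → exceeds? (φ^ j (initial i))) N exN)

  -- Words with a common letter

  ∑-fibre≤1 : ∀ {n} t (f : Fin t → Fin n) i → (∀ a b → f a ≡ f b → a ≡ b) → ∑ (allFin t) (λ a → ⟦ ⌊ i Finₚ.≟ f a ⌋ ⟧) ≤ 1
  ∑-fibre≤1 t f i f-inj = ∑-subsingleton t _ (λ a b p q → f-inj a b (trans (sym (toWitness p)) (toWitness q)))

  any-intro : ∀ {A : Set} (p : A → Bool) {xs x} → x ∈ xs → T (p x) → T (any p xs)
  any-intro p x∈xs px = any⁺ p (lose x∈xs px)

  any-elim : ∀ {A : Set} (p : A → Bool) xs → T (any p xs) → ∃ λ x → T (p x)
  any-elim p xs t with find (any⁻ p xs t)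
  ... | x , _ , px = x , px

  4ab≤[a+b]² : ∀ a b → 4 * (a * b) ≤ (a + b) * (a + b)
  4ab≤[a+b]² a b with ≤-total a b
  ... | inj₁ a≤b = subst (λ b → 4 * (a * b) ≤ (a + b) * (a + b)) (m+[n∸m]≡n a≤b) (ordered a (b ∸ a))
    where
    expand : ∀ a e → 4 * (a * (a + e)) + e * e ≡ (a + (a + e)) * (a + (a + e))
    expand = solve-∀
    ordered : ∀ a e → 4 * (a * (a + e)) ≤ (a + (a + e)) * (a + (a + e))
    ordered a e = ≤-trans (m≤m+n _ (e * e)) (≤-reflexive (expand a e))
  ... | inj₂ b≤a = subst (λ a → 4 * (a * b) ≤ (a + b) * (a + b)) (m+[n∸m]≡n b≤a) (ordered b (a ∸ b))
    where
    expand : ∀ b e → 4 * ((b + e) * b) + e * e ≡ (b + e + b) * (b + e + b)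
    expand = solve-∀
    ordered : ∀ b e → 4 * ((b + e) * b) ≤ (b + e + b) * (b + e + b)
    ordered b e = ≤-trans (m≤m+n _ (e * e)) (≤-reflexive (expand b e))

  module Words (q : ℕ) where
    open ≤-Reasoning

    words : ∀ d → List (Vec (Fin q) d)
    words zero    = [] ∷ []
    words (suc d) = cartesianProductWith _∷_ (allFin q) (words d)

    ∈-words : ∀ {d} (x : Vec (Fin q) d) → x ∈ words d
    ∈-words []      = here refl
    ∈-words (a ∷ x) = ∈-cartesianProductWith⁺ _∷_ (∈-allFin a) (∈-words x)

    ∑-words : ∀ d f → ∑ (words (suc d)) f ≡ ∑ (allFin q) (λ a → ∑ (words d) (λ x → f (a ∷ x)))
    ∑-words d f = ∑-cartesianProductWith _∷_ (allFin q) (words d) f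

    ∑-letters : ∑ (allFin q) (λ _ → 1) ≡ q
    ∑-letters = trans (sym (length-as-∑ (allFin q))) (length-tabulate {n = q} (λ i → i))

    length-words : ∀ d → length (words d) ≡ q ^ d
    length-words zero    = refl
    length-words (suc d) = begin-equality
      length (words (suc d))                             ≡⟨ length-as-∑ (words (suc d)) ⟩
      ∑ (words (suc d)) (λ _ → 1)                        ≡⟨ ∑-words d (λ _ → 1) ⟩
      ∑ (allFin q) (λ _ → ∑ (words d) (λ _ → 1))         ≡⟨ ∑-product (allFin q) (words d) (λ _ → 1) (λ _ → 1) ⟩
      ∑ (allFin q) (λ _ → 1) * ∑ (words d) (λ _ → 1)     ≡⟨ cong₂ _*_ ∑-letters (trans (sym (length-as-∑ (words d))) (length-words d)) ⟩
      q * q ^ d                                          ∎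

    meet : ∀ {d} → Vec (Fin q) d → Vec (Fin q) d → Bool
    meet []      []      = false
    meet (a ∷ x) (b ∷ y) = ⌊ a Finₚ.≟ b ⌋ ∨ meet x y

    meet-sym : ∀ {d} (x y : Vec (Fin q) d) → meet x y ≡ meet y x
    meet-sym []      []      = refl
    meet-sym (a ∷ x) (b ∷ y) = cong₂ _∨_ (≟-sym a b) (meet-sym x y)
      where
      ≟-sym : ∀ (a b : Fin q) → ⌊ a Finₚ.≟ b ⌋ ≡ ⌊ b Finₚ.≟ a ⌋
      ≟-sym a b with a Finₚ.≟ b | b Finₚ.≟ a
      ... | yes _ | yes _ = refl
      ... | no _  | no _  = refl
      ... | yes p | no ¬q = ⊥-elim (¬q (sym p))
      ... | no ¬p | yes q = ⊥-elim (¬p (sym q))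

    avoiding : ∀ {d} (x : Vec (Fin q) d) → pred q ^ d ≤ ∑ (words d) (λ y → ⟦ not (meet x y) ⟧)
    avoiding []            = ≤-refl
    avoiding {suc d} (a ∷ x) = begin
      pred q * pred q ^ d                                ≤⟨ *-mono-≤ letters (avoiding x) ⟩
      ∑ (allFin q) (λ b → ⟦ not ⌊ a Finₚ.≟ b ⌋ ⟧) * ∑ (words d) (λ y → ⟦ not (meet x y) ⟧)
        ≡⟨ ∑-product (allFin q) (words d) _ _ ⟨
      ∑ (allFin q) (λ b → ∑ (words d) (λ y → ⟦ not ⌊ a Finₚ.≟ b ⌋ ⟧ * ⟦ not (meet x y) ⟧))
        ≡⟨ ∑-cong (allFin q) (λ b → ∑-cong (words d) (λ y → de-morgan ⌊ a Finₚ.≟ b ⌋ (meet x y))) ⟩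
      ∑ (allFin q) (λ b → ∑ (words d) (λ y → ⟦ not (meet (a ∷ x) (b ∷ y)) ⟧))
        ≡⟨ ∑-words d (λ y → ⟦ not (meet (a ∷ x) y) ⟧) ⟨
      ∑ (words (suc d)) (λ y → ⟦ not (meet (a ∷ x) y) ⟧) ∎
      where
      de-morgan : ∀ p r → ⟦ not p ⟧ * ⟦ not r ⟧ ≡ ⟦ not (p ∨ r) ⟧
      de-morgan true  r = refl
      de-morgan false r = +-identityʳ ⟦ not r ⟧
      others = ∑ (allFin q) (λ b → ⟦ not ⌊ a Finₚ.≟ b ⌋ ⟧)
      letters : pred q ≤ others
      letters = pred-mono-≤ {q} {suc others} (begin
        q                                                ≡⟨ ∑-letters ⟨
        ∑ (allFin q) (λ _ → 1)                           ≡⟨ ∑-cong (allFin q) (λ b → ⟦⟧-not ⌊ a Finₚ.≟ b ⌋) ⟨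
        ∑ (allFin q) (λ b → ⟦ not ⌊ a Finₚ.≟ b ⌋ ⟧ + ⟦ ⌊ a Finₚ.≟ b ⌋ ⟧) ≡⟨ ∑-+ (allFin q) _ _ ⟩
        others + ∑ (allFin q) (λ b → ⟦ ⌊ a Finₚ.≟ b ⌋ ⟧)  ≤⟨ +-monoʳ-≤ others (∑-fibre≤1 q (λ b → b) a (λ _ _ e → e)) ⟩
        others + 1                                       ≡⟨ +-comm others 1 ⟩
        suc others                                       ∎)

    Separated : ∀ {d} → (Vec (Fin q) d → Bool) → (Vec (Fin q) d → Bool) → Set
    Separated s t = ∀ x y → T (s x) → T (t y) → ¬ T (meet x y)

    size : ∀ {d} → (Vec (Fin q) d → Bool) → ℕ
    size {d} s = ∑ (words d) (λ x → ⟦ s x ⟧)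

    -- In each coordinate two separated sets use disjoint sets of letters.
    separated-bound : ∀ d (s t : Vec (Fin q) d → Bool) → Separated s t →
      4 ^ d * (size s * size t) ≤ q ^ d * q ^ d
    separated-bound zero    s t sep = ≤-trans (≤-reflexive (+-identityʳ _)) (*-mono-≤ (single s) (single t))
      where
      single : ∀ (s : Vec (Fin q) 0 → Bool) → size s ≤ 1
      single s = ≤-trans (≤-reflexive (+-identityʳ _)) (⟦⟧≤1 (s []))
    separated-bound (suc d) s t sep = begin
      -- Each set is enlarged to the product of its first letters and its tails. A common first
      -- letter would already be a meeting, so the letter sets are disjoint and the AM-GM inequality
      -- gives the factor 4; a meeting of tails would be one of the words, so the tails are
      -- separated again.
      4 * 4 ^ d * (size s * size t)                      ≤⟨ *-monoʳ-≤ (4 * 4 ^ d) (*-mono-≤ (projections s) (projections t)) ⟩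
      4 * 4 ^ d * (heads s * size (tails s) * (heads t * size (tails t)))
        ≡⟨ regroup₁ (4 ^ d) (heads s) (size (tails s)) (heads t) (size (tails t)) ⟩
      4 * (heads s * heads t) * (4 ^ d * (size (tails s) * size (tails t)))
        ≤⟨ *-mono-≤ letters (separated-bound d (tails s) (tails t) tails-sep) ⟩
      q * q * (q ^ d * q ^ d)                            ≡⟨ regroup₂ q (q ^ d) ⟩
      q * q ^ d * (q * q ^ d)                            ∎
      where
      head : (Vec (Fin q) (suc d) → Bool) → Fin q → Bool
      head s a = any (λ x → s (a ∷ x)) (words d)
      heads : (Vec (Fin q) (suc d) → Bool) → ℕ
      heads s = ∑ (allFin q) (λ a → ⟦ head s a ⟧)
      tails : (Vec (Fin q) (suc d) → Bool) → Vec (Fin q) d → Bool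
      tails s x = any (λ a → s (a ∷ x)) (allFin q)
      regroup₁ : ∀ f a b c e → 4 * f * (a * b * (c * e)) ≡ 4 * (a * c) * (f * (b * e))
      regroup₁ = solve-∀
      regroup₂ : ∀ a b → a * a * (b * b) ≡ a * b * (a * b)
      regroup₂ = solve-∀
      projections : ∀ s → size s ≤ heads s * size (tails s)
      projections s = begin
        size s                                                           ≡⟨ ∑-words d (λ x → ⟦ s x ⟧) ⟩
        ∑ (allFin q) (λ a → ∑ (words d) (λ x → ⟦ s (a ∷ x) ⟧))           ≤⟨ ∑-mono (allFin q) (λ a → ∑-mono (words d) (pointwise a)) ⟩
        ∑ (allFin q) (λ a → ∑ (words d) (λ x → ⟦ head s a ⟧ * ⟦ tails s x ⟧)) ≡⟨ ∑-product (allFin q) (words d) _ _ ⟩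
        heads s * size (tails s)                                         ∎
        where
        pointwise : ∀ a x → ⟦ s (a ∷ x) ⟧ ≤ ⟦ head s a ⟧ * ⟦ tails s x ⟧
        pointwise a x = ≤-trans (⟦⟧-mono (s (a ∷ x)) (head s a ∧ tails s x)
            (λ p → Equivalence.from T-∧ (any-intro (λ x → s (a ∷ x)) (∈-words x) p , any-intro (λ a → s (a ∷ x)) (∈-allFin a) p)))
          (≤-reflexive (⟦⟧-∧ (head s a) (tails s x)))
      letters : 4 * (heads s * heads t) ≤ q * q
      letters = ≤-trans (4ab≤[a+b]² (heads s) (heads t)) (*-mono-≤ disjoint disjoint)
        where
        disjoint : heads s + heads t ≤ q
        disjoint = begin
          heads s + heads t                                    ≡⟨ ∑-+ (allFin q) _ _ ⟨
          ∑ (allFin q) (λ a → ⟦ head s a ⟧ + ⟦ head t a ⟧)     ≤⟨ ∑-mono (allFin q) (λ a → ⟦⟧-disjoint (head s a) (head t a) (clash a)) ⟩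
          ∑ (allFin q) (λ _ → 1)                               ≡⟨ ∑-letters ⟩
          q                                                    ∎
          where
          clash : ∀ a → T (head s a) → T (head t a) → ⊥
          clash a p r with any-elim _ (words d) p | any-elim _ (words d) r
          ... | x , sx | y , ty = sep (a ∷ x) (a ∷ y) sx ty
            (Equivalence.from (T-∨ {⌊ a Finₚ.≟ a ⌋}) (inj₁ (fromWitness refl)))
      tails-sep : Separated (tails s) (tails t)
      tails-sep x y p r m with any-elim _ (allFin q) p | any-elim _ (allFin q) r
      ... | a , sx | b , ty = sep (a ∷ x) (b ∷ y) sx ty (Equivalence.from (T-∨ {⌊ a Finₚ.≟ b ⌋}) (inj₂ m))

  -- The colouring

  ∑-member : ∀ {A : Set} {xs : List A} {x} (f : A → ℕ) → x ∈ xs → f x ≤ ∑ xs f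
  ∑-member f (here refl) = m≤m+n _ _
  ∑-member f (there p)   = ≤-trans (∑-member f p) (m≤n+m _ _)

  ∑-injective : ∀ {t n} (f : Fin t → Fin n) → (∀ a b → f a ≡ f b → a ≡ b) → ∀ g →
    ∑ (allFin t) (g ∘ f) ≤ ∑ (allFin n) g
  ∑-injective {t} {n} f f-inj g = begin
    ∑ (allFin t) (g ∘ f)                                                  ≤⟨ ∑-mono (allFin t) spread ⟩
    ∑ (allFin t) (λ a → ∑ (allFin n) (λ i → g i * ⟦ ⌊ i Finₚ.≟ f a ⌋ ⟧))   ≡⟨ ∑-swap (allFin t) (allFin n) _ ⟩
    ∑ (allFin n) (λ i → ∑ (allFin t) (λ a → g i * ⟦ ⌊ i Finₚ.≟ f a ⌋ ⟧))   ≡⟨ ∑-cong (allFin n) (λ i → ∑-* (allFin t) (g i) _) ⟩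
    ∑ (allFin n) (λ i → g i * ∑ (allFin t) (λ a → ⟦ ⌊ i Finₚ.≟ f a ⌋ ⟧))   ≤⟨ ∑-mono (allFin n) (λ i → *-monoʳ-≤ (g i) (∑-fibre≤1 t f i f-inj)) ⟩
    ∑ (allFin n) (λ i → g i * 1)                                          ≡⟨ ∑-cong (allFin n) (λ i → *-identityʳ (g i)) ⟩
    ∑ (allFin n) g                                                        ∎
    where
    open ≤-Reasoning
    spread : ∀ a → g (f a) ≤ ∑ (allFin n) (λ i → g i * ⟦ ⌊ i Finₚ.≟ f a ⌋ ⟧)
    spread a = begin
      g (f a)                                             ≡⟨ *-identityʳ (g (f a)) ⟨
      g (f a) * 1                                         ≡⟨ cong (g (f a) *_) (⟦⟧-true ⌊ f a Finₚ.≟ f a ⌋ (fromWitness refl)) ⟨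
      g (f a) * ⟦ ⌊ f a Finₚ.≟ f a ⌋ ⟧                    ≤⟨ ∑-member (λ i → g i * ⟦ ⌊ i Finₚ.≟ f a ⌋ ⟧) (∈-allFin (f a)) ⟩
      ∑ (allFin n) (λ i → g i * ⟦ ⌊ i Finₚ.≟ f a ⌋ ⟧)     ∎

  4^d≡2^d*2^d : ∀ d → 4 ^ d ≡ 2 ^ d * 2 ^ d
  4^d≡2^d*2^d zero    = refl
  4^d≡2^d*2^d (suc d) = trans (cong (4 *_) (4^d≡2^d*2^d d)) (regroup (2 ^ d))
    where
    regroup : ∀ e → 4 * (e * e) ≡ 2 * e * (2 * e)
    regroup = solve-∀

  -- Vertex i receives the label at list position i mod L. For every n each position is then used n
  -- / L or n / L + 1 times, so any large n can be treated without divisibility conditions.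
  module Cyclic {W : Set} (ws : List W) (L>0 : 0 < length ws) where
    L : ℕ
    L = length ws

    instance
      L-nonZero : NonZero L
      L-nonZero = >-nonZero L>0

    label : ℕ → W
    label i = lookup ws (i mod L)

    mod-cong : ∀ i j → i % L ≡ j % L → i mod L ≡ j mod L
    mod-cong i j eq = Finₚ.fromℕ<-cong _ _ eq (m%n<n i L) (m%n<n j L)

    label-period : ∀ i → label (L + i) ≡ label i
    label-period i = cong (lookup ws) (mod-cong (L + i) i (trans (cong (_% L) (+-comm L i)) ([m+n]%n≡m%n i L)))

    label-toℕ : ∀ r → label (toℕ r) ≡ lookup ws r
    label-toℕ r = cong (lookup ws) (Finₚ.toℕ-injective
      (trans (Finₚ.toℕ-fromℕ< (m%n<n (toℕ r) L)) (m<n⇒m%n≡m (Finₚ.toℕ<n r))))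

    ∑<-label : ∀ h → ∑< L (h ∘ label) ≡ ∑ ws h
    ∑<-label h = trans (sym (∑-allFin L (h ∘ label)))
      (trans (∑-cong (allFin L) (λ r → cong h (label-toℕ r))) (∑-lookup ws h))

    ∑<-label-* : ∀ K h → ∑< (K * L) (h ∘ label) ≡ K * ∑ ws h
    ∑<-label-* zero    h = refl
    ∑<-label-* (suc K) h = trans (∑<-split L (K * L) (h ∘ label))
      (cong₂ _+_ (∑<-label h) (trans (∑<-cong (K * L) (λ i _ → cong h (label-period i))) (∑<-label-* K h)))

    label-lower : ∀ n h → (n / L) * ∑ ws h ≤ ∑ (allFin n) (λ i → h (label (toℕ i)))
    label-lower n h = begin
      (n / L) * ∑ ws h                          ≡⟨ ∑<-label-* (n / L) h ⟨
      ∑< (n / L * L) (h ∘ label)                ≤⟨ ∑<-monoˡ (h ∘ label) (≤-trans (m≤n+m _ (n % L)) (≤-reflexive (sym (m≡m%n+[m/n]*n n L)))) ⟩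
      ∑< n (h ∘ label)                          ≡⟨ ∑-allFin n (h ∘ label) ⟨
      ∑ (allFin n) (λ i → h (label (toℕ i)))    ∎
      where open ≤-Reasoning

    label-upper : ∀ n h → ∑ (allFin n) (λ i → h (label (toℕ i))) ≤ suc (n / L) * ∑ ws h
    label-upper n h = begin
      ∑ (allFin n) (λ i → h (label (toℕ i)))    ≡⟨ ∑-allFin n (h ∘ label) ⟩
      ∑< n (h ∘ label)                          ≤⟨ ∑<-monoˡ (h ∘ label) (≤-trans (≤-reflexive (m≡m%n+[m/n]*n n L)) (+-monoˡ-≤ (n / L * L) (<⇒≤ (m%n<n n L)))) ⟩
      ∑< (suc (n / L) * L) (h ∘ label)          ≡⟨ ∑<-label-* (suc (n / L)) h ⟩
      suc (n / L) * ∑ ws h                      ∎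
      where open ≤-Reasoning

  module BlowUp (G : Balanced) (q d : ℕ) (q>0 : 0 < q) where
    open Balanced G
    open Words q
    open ≤-Reasoning

    W : Set
    W = V × Vec (Fin q) d

    ws : List W
    ws = cartesianProduct verts (words d)

    Q : ℕ
    Q = q ^ d

    ∑-ws : ∀ f → ∑ ws f ≡ ∑ verts (λ v → ∑ (words d) (λ x → f (v , x)))
    ∑-ws f = ∑-cartesianProductWith _,_ verts (words d) f

    length-ws : length ws ≡ M * Q
    length-ws = begin-equality
      length ws                                          ≡⟨ length-as-∑ ws ⟩
      ∑ ws (λ _ → 1)                                     ≡⟨ ∑-ws (λ _ → 1) ⟩
      ∑ verts (λ _ → ∑ (words d) (λ _ → 1))              ≡⟨ ∑-const verts _ ⟩
      M * ∑ (words d) (λ _ → 1)                          ≡⟨ cong (M *_) (trans (sym (length-as-∑ (words d))) (length-words d)) ⟩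
      M * Q                                              ∎

    length-ws>0 : 0 < length ws
    length-ws>0 = subst (0 <_) (sym length-ws) (*-mono-≤ (≤-trans D>0 D≤M) (m^n>0 q {{>-nonZero q>0}} d))

    open Cyclic ws length-ws>0 public

    _≟ʷ_ : DecidableEquality W
    _≟ʷ_ = ≡-dec _≟_ (Vecₚ.≡-dec Finₚ._≟_)

    colour : W → W → Colour
    colour (u , x) (v , y) = if E u v then (if meet x y then red else purple) else blue

    colour-sym : ∀ w w′ → colour w w′ ≡ colour w′ w
    colour-sym (u , x) (v , y) =
      cong₂ (λ e b → if e then (if b then red else purple) else blue) (E-sym u v) (meet-sym x y)

    nonblue⇒E : ∀ w w′ → RedOrPurple (colour w w′) → T (E (proj₁ w) (proj₁ w′))
    nonblue⇒E (u , x) (v , y) p with E u v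
    ... | true  = tt
    ... | false = p

    E⇒nonmeeting : ∀ w w′ → BlueOrPurple (colour w w′) → T (E (proj₁ w) (proj₁ w′)) → ¬ T (meet (proj₂ w) (proj₂ w′))
    E⇒nonmeeting (u , x) (v , y) p e m with E u v | meet x y
    ... | true | true = p

    -- Distinct vertices of K_n may carry the same label. Blue between them allows a set of labels
    -- to be tested including equal pairs, and removes the diagonal from the purple count.
    diagonal-blue : ∀ w → colour w w ≡ blue
    diagonal-blue (u , x) with E u u in eq
    ... | true  = ⊥-elim (irreflexive u (subst T (sym eq) tt))
    ... | false = refl

    purple-weight : ∀ u x v y → ⟦ isPurple (colour (u , x) (v , y)) ⟧ ≡ ⟦ E u v ⟧ * ⟦ not (meet x y) ⟧
    purple-weight u x v y with E u v | meet x y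
    ... | true  | true  = refl
    ... | true  | false = refl
    ... | false | _     = refl

    purple-degree : ∀ w → D * pred q ^ d ≤ ∑ ws (λ w′ → ⟦ isPurple (colour w w′) ⟧)
    purple-degree (u , x) = begin
      D * pred q ^ d                                                                 ≤⟨ *-mono-≤ (degree u) (avoiding x) ⟩
      ∑ verts (λ v → ⟦ E u v ⟧) * ∑ (words d) (λ y → ⟦ not (meet x y) ⟧)            ≡⟨ ∑-product verts (words d) _ _ ⟨
      ∑ verts (λ v → ∑ (words d) (λ y → ⟦ E u v ⟧ * ⟦ not (meet x y) ⟧))            ≡⟨ ∑-cong verts (λ v → ∑-cong (words d) (λ y → purple-weight u x v y)) ⟨
      ∑ verts (λ v → ∑ (words d) (λ y → ⟦ isPurple (colour (u , x) (v , y)) ⟧))     ≡⟨ ∑-ws _ ⟨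
      ∑ ws (λ w′ → ⟦ isPurple (colour (u , x) w′) ⟧)                                 ∎

    -- Fibres of relative size above 2⁻ᵈ sit over an independent set of G.
    red-independence : ∀ (s : W → Bool) → (∀ w w′ → T (s w) → T (s w′) → BlueOrPurple (colour w w′)) →
      2 ^ d * ∑ ws (λ w → ⟦ s w ⟧) ≤ Q * (D * 2 ^ d + M)
    red-independence s nonred = begin
      2 ^ d * ∑ ws (λ w → ⟦ s w ⟧)                       ≡⟨ cong (2 ^ d *_) (∑-ws _) ⟩
      2 ^ d * ∑ verts fibre                              ≡⟨ ∑-* verts (2 ^ d) fibre ⟨
      ∑ verts (λ v → 2 ^ d * fibre v)                    ≤⟨ ∑-mono verts pointwise ⟩
      -- A big fibre has at most Q words and a small one at most Q/2ᵈ; charging the small bound to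
      -- every listed vertex produces the summand M·Q.
      ∑ verts (λ v → 2 ^ d * Q * ⟦ big v ⟧ + Q)          ≡⟨ ∑-+ verts _ _ ⟩
      ∑ verts (λ v → 2 ^ d * Q * ⟦ big v ⟧) + ∑ verts (λ _ → Q) ≡⟨ cong₂ _+_ (∑-* verts (2 ^ d * Q) _) (∑-const verts Q) ⟩
      2 ^ d * Q * ∑ verts (λ v → ⟦ big v ⟧) + M * Q      ≤⟨ +-monoˡ-≤ (M * Q) (*-monoʳ-≤ (2 ^ d * Q) (independence big big-ind)) ⟩
      2 ^ d * Q * D + M * Q                              ≡⟨ regroup (2 ^ d) Q D M ⟩
      Q * (D * 2 ^ d + M)                                ∎
      where
      fibre : V → ℕ
      fibre v = size (λ x → s (v , x))
      big : V → Bool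
      big v = ⌊ Q <? 2 ^ d * fibre v ⌋
      regroup : ∀ e q D M → e * q * D + M * q ≡ q * (D * e + M)
      regroup = solve-∀
      fibre≤Q : ∀ v → fibre v ≤ Q
      fibre≤Q v = ≤-trans (∑-mono (words d) (λ x → ⟦⟧≤1 (s (v , x)))) (≤-reflexive (trans (sym (length-as-∑ (words d))) (length-words d)))
      pointwise : ∀ v → 2 ^ d * fibre v ≤ 2 ^ d * Q * ⟦ big v ⟧ + Q
      pointwise v with Q <? 2 ^ d * fibre v
      ... | yes _ = ≤-trans (*-monoʳ-≤ (2 ^ d) (fibre≤Q v)) (≤-trans (≤-reflexive (sym (*-identityʳ (2 ^ d * Q)))) (m≤m+n _ Q))
      ... | no ≮  = ≤-trans (≮⇒≥ ≮) (m≤n+m Q _)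
      big-ind : Independent E big
      -- Two big fibres over an edge would be separated, since no red edge joins them, although
      -- their sizes scaled by 2ᵈ multiply to more than Q².
      big-ind u v bu bv e = <⇒≱ (*-mono-< (toWitness bu) (toWitness bv)) (begin
        2 ^ d * fibre u * (2 ^ d * fibre v)              ≡⟨ interchange (2 ^ d) (fibre u) (fibre v) ⟩
        2 ^ d * 2 ^ d * (fibre u * fibre v)              ≡⟨ cong (_* (fibre u * fibre v)) (4^d≡2^d*2^d d) ⟨
        4 ^ d * (fibre u * fibre v)                      ≤⟨ separated-bound d _ _ (λ x y sx sy → E⇒nonmeeting (u , x) (v , y) (nonred _ _ sx sy) e) ⟩
        Q * Q                                            ∎)
        where
        interchange : ∀ e a b → e * a * (e * b) ≡ e * e * (a * b)
        interchange = solve-∀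

    χ : ∀ n → Colouring n
    χ n = record
      { col = λ i j → colour (label (toℕ i)) (label (toℕ j))
      ; sym = λ i j → colour-sym (label (toℕ i)) (label (toℕ j)) }

    triangle-free-χ : ∀ n → KFree RedOrPurple (χ n) 3
    triangle-free-χ n (f , _ , edges) = triangle-free _ _ _
      (adjacent Fin.zero (Fin.suc Fin.zero) λ ())
      (adjacent (Fin.suc Fin.zero) (Fin.suc (Fin.suc Fin.zero)) λ ())
      (adjacent Fin.zero (Fin.suc (Fin.suc Fin.zero)) λ ())
      where
      place : Fin 3 → W
      place a = label (toℕ (f a))
      adjacent : ∀ a b → a ≢ b → T (E (proj₁ (place a)) (proj₁ (place b)))
      adjacent a b a≢b = nonblue⇒E (place a) (place b) (edges a b a≢b)

    -- The labels occurring in the clique form a set without red pairs, to which `red-independence`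
    -- applies. Each listed label is carried by at most n / L + 1 vertices, which bounds the clique
    -- itself.
    clique-bound : ∀ n t → HasClique BlueOrPurple (χ n) t → 2 ^ d * t ≤ suc (n / L) * (Q * (D * 2 ^ d + M))
    clique-bound n t (f , f-inj , edges) = begin
      2 ^ d * t                                          ≤⟨ *-monoʳ-≤ (2 ^ d) t≤ ⟩
      2 ^ d * (suc (n / L) * ∑ ws (λ w → ⟦ s w ⟧))       ≡⟨ exchange (2 ^ d) (suc (n / L)) _ ⟩
      suc (n / L) * (2 ^ d * ∑ ws (λ w → ⟦ s w ⟧))       ≤⟨ *-monoʳ-≤ (suc (n / L)) (red-independence s nonred) ⟩
      suc (n / L) * (Q * (D * 2 ^ d + M))                ∎
      where
      exchange : ∀ a b c → a * (b * c) ≡ b * (a * c)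
      exchange = solve-∀
      place : Fin t → W
      place a = label (toℕ (f a))
      s : W → Bool
      s w = any (λ a → ⌊ place a ≟ʷ w ⌋) (allFin t)
      nonred : ∀ w w′ → T (s w) → T (s w′) → BlueOrPurple (colour w w′)
      nonred w w′ p r with any-elim _ (allFin t) p | any-elim _ (allFin t) r
      ... | a , pa | b , pb with toWitness {a? = place a ≟ʷ w} pa | toWitness {a? = place b ≟ʷ w′} pb
      ...   | refl | refl with a Finₚ.≟ b
      ...     | yes refl = subst BlueOrPurple (sym (diagonal-blue (place a))) tt
      ...     | no a≢b   = edges a b a≢b
      t≤ : t ≤ suc (n / L) * ∑ ws (λ w → ⟦ s w ⟧)
      t≤ = begin
        t                                                ≡⟨ Words.∑-letters t ⟨
        ∑ (allFin t) (λ _ → 1)                           ≡⟨ ∑-cong (allFin t) (λ a → ⟦⟧-true (s (place a)) (any-intro (λ b → ⌊ place b ≟ʷ place a ⌋) (∈-allFin a) (fromWitness refl))) ⟨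
        ∑ (allFin t) (λ a → ⟦ s (place a) ⟧)             ≤⟨ ∑-injective f (λ a b → f-inj) (λ i → ⟦ s (label (toℕ i)) ⟧) ⟩
        ∑ (allFin n) (λ i → ⟦ s (label (toℕ i)) ⟧)       ≤⟨ label-upper n (⟦_⟧ ∘ s) ⟩
        suc (n / L) * ∑ ws (λ w → ⟦ s w ⟧)               ∎

    -- Purple degrees are summed over all rows of the full matrix; `purpleCount` sees only pairs i <
    -- j, whence the factor 2.
    purple-bound : ∀ n → n * ((n / L) * (D * pred q ^ d)) ≤ 2 * purpleCount (χ n)
    purple-bound n = begin
      n * bound                                              ≡⟨ cong (_* bound) (trans (length-as-∑ (allFin n)) (Words.∑-letters n)) ⟨
      length (allFin n) * bound                              ≡⟨ ∑-const (allFin n) bound ⟨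
      ∑ (allFin n) (λ _ → bound)                             ≤⟨ ∑-mono (allFin n) row ⟩
      ∑ (allFin n) (λ i → ∑ (allFin n) (λ j → ⟦ P i j ⟧)) ≤⟨ ∑-mono (allFin n) (λ i → ∑-mono (allFin n) (split i)) ⟩
      ∑ (allFin n) (λ i → ∑ (allFin n) (λ j → up i j + up j i)) ≡⟨ ∑-cong (allFin n) (λ i → ∑-+ (allFin n) (up i) (λ j → up j i)) ⟩
      ∑ (allFin n) (λ i → ∑ (allFin n) (up i) + ∑ (allFin n) (λ j → up j i)) ≡⟨ ∑-+ (allFin n) _ _ ⟩
      p + ∑ (allFin n) (λ i → ∑ (allFin n) (λ j → up j i)) ≡⟨ cong (p +_) (∑-swap (allFin n) (allFin n) up) ⟨
      p + p                                              ≡⟨ cong (p +_) (+-identityʳ p) ⟨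
      2 * p                                              ∎
      where
      bound = (n / L) * (D * pred q ^ d)
      p = purpleCount (χ n)
      P : Fin n → Fin n → Bool
      P i j = isPurple (col (χ n) i j)
      up : Fin n → Fin n → ℕ
      up i j = ⟦ (toℕ i <ᵇ toℕ j) ∧ P i j ⟧
      row : ∀ i → bound ≤ ∑ (allFin n) (λ j → ⟦ P i j ⟧)
      row i = ≤-trans (*-monoʳ-≤ (n / L) (purple-degree (label (toℕ i)))) (label-lower n _)
      up-< : ∀ i j → toℕ i < toℕ j → ⟦ P i j ⟧ ≤ up i j
      up-< i j i<j = ⟦⟧-mono (P i j) _ (λ t → Equivalence.from T-∧ (<⇒<ᵇ i<j , t))
      split : ∀ i j → ⟦ P i j ⟧ ≤ up i j + up j i
      split i j with <-cmp (toℕ i) (toℕ j)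
      ... | tri< i<j _ _ = ≤-trans (up-< i j i<j) (m≤m+n _ _)
      ... | tri> _ _ j<i = ≤-trans (≤-reflexive (cong (⟦_⟧ ∘ isPurple) (Colouring.sym (χ n) i j))) (≤-trans (up-< j i j<i) (m≤n+m _ _))
      ... | tri≈ _ i≡j _ with Finₚ.toℕ-injective i≡j
      ...   | refl = ≤-trans (≤-reflexive (cong (⟦_⟧ ∘ isPurple) (diagonal-blue (label (toℕ i))))) z≤n

  -- Densities

  n<2^n : ∀ n → n < 2 ^ n
  n<2^n zero    = s≤s z≤n
  n<2^n (suc n) = begin-strict
    suc n               ≤⟨ n<2^n n ⟩
    2 ^ n               <⟨ m<m+n (2 ^ n) (m^n>0 2 n) ⟩
    2 ^ n + 2 ^ n       ≡⟨ cong (2 ^ n +_) (+-identityʳ (2 ^ n)) ⟨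
    2 ^ suc n           ∎
    where open ≤-Reasoning

  -- (1 − 1/q)ᵈ ≥ 1 − d/q for q = suc u
  bernoulli : ∀ u d → suc u ^ d * suc u ≤ suc u * u ^ d + d * suc u ^ d
  bernoulli u zero    = ≤-reflexive (trivial u)
    where
    trivial : ∀ u → 1 * suc u ≡ suc u * 1 + 0
    trivial = solve-∀
  bernoulli u (suc d) = begin
    q * q ^ d * q                               ≡⟨ *-assoc q (q ^ d) q ⟩
    q * (q ^ d * q)                             ≤⟨ *-monoʳ-≤ q (bernoulli u d) ⟩
    q * (q * u ^ d + d * q ^ d)                 ≡⟨ expand u (u ^ d) d (q ^ d) ⟩
    q * (u * u ^ d) + (q * u ^ d + d * (q * q ^ d)) ≤⟨ +-monoʳ-≤ (q * (u * u ^ d)) (+-monoˡ-≤ (d * (q * q ^ d)) (*-monoʳ-≤ q (^-monoˡ-≤ d (n≤1+n u)))) ⟩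
    q * (u * u ^ d) + (q * q ^ d + d * (q * q ^ d)) ∎
    where
    open ≤-Reasoning
    q = suc u
    expand : ∀ u a d b → suc u * (suc u * a + d * b) ≡ suc u * (u * a) + (suc u * a + d * (suc u * b))
    expand = solve-∀

  -- With q = (d + 1)·h letters the loss d/q is at most 1/h, so the red edges take at most a
  -- fraction 1/h of each bipartite graph.
  bernoulli-h : ∀ h d → 0 < h → (suc d * h) ^ d * h ≤ h * pred (suc d * h) ^ d + (suc d * h) ^ d
  bernoulli-h (suc h′) d _ = *-cancelˡ-≤ (suc d) (begin
    suc d * (q ^ d * h)                         ≡⟨ exchange (suc d) (q ^ d) h ⟩
    q ^ d * (suc d * h)                         ≤⟨ bernoulli u d ⟩
    suc d * h * u ^ d + d * q ^ d               ≤⟨ +-monoʳ-≤ (suc d * h * u ^ d) (*-monoˡ-≤ (q ^ d) (n≤1+n d)) ⟩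
    suc d * h * u ^ d + suc d * q ^ d           ≡⟨ factor (suc d) h (u ^ d) (q ^ d) ⟩
    suc d * (h * u ^ d + q ^ d)                 ∎)
    where
    open ≤-Reasoning
    h = suc h′
    q = suc d * h
    u = pred q
    exchange : ∀ a b c → a * (b * c) ≡ b * (a * c)
    exchange = solve-∀
    factor : ∀ a h b c → a * h * b + a * c ≡ a * (h * b + c)
    factor = solve-∀

  -- By integrality D·r < M·p leaves a whole unit, worth E·n after scaling, where E stands for 2ᵈ.
  -- As r·M < E, this slack covers r·M·n, the cost of the small fibres, and a further n, which
  -- exceeds the cost r·L·(D·E + M) of rounding n / L up.
  too-large-clique : ∀ p r M D n w L Q E t → L ≡ M * Q → w * L ≤ n → D * r < M * p →
    r * (L * (D * E + M)) < n → r * M < E → p * n ≤ r * t → ¬ E * t ≤ suc w * (Q * (D * E + M))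
  too-large-clique p r M D n w L Q E t refl wL≤n ratio n-large E-large pn≤rt clique = <-irrefl refl (begin-strict
    E * (M * p * n)                             ≡⟨ regroup₁ E M p n ⟩
    M * E * (p * n)                             ≤⟨ *-monoʳ-≤ (M * E) pn≤rt ⟩
    M * E * (r * t)                             ≡⟨ regroup₂ M E r t ⟩
    r * (M * (E * t))                           ≤⟨ *-monoʳ-≤ r (*-monoʳ-≤ M clique) ⟩
    r * (M * (suc w * (Q * X)))                 ≡⟨ regroup₃ r M w Q X ⟩
    r * ((L + w * L) * X)                       ≤⟨ *-monoʳ-≤ r (*-monoˡ-≤ X (+-monoʳ-≤ L wL≤n)) ⟩
    r * ((L + n) * X)                           ≡⟨ regroup₄ r L n D E M ⟩
    E * (D * r * n) + r * M * n + r * (L * X)   <⟨ +-monoʳ-< (E * (D * r * n) + r * M * n) n-large ⟩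
    E * (D * r * n) + r * M * n + n             ≡⟨ regroup₅ E (D * r) n (r * M) ⟩
    E * (D * r * n) + suc (r * M) * n           ≤⟨ +-monoʳ-≤ (E * (D * r * n)) (*-monoˡ-≤ n E-large) ⟩
    E * (D * r * n) + E * n                     ≡⟨ regroup₆ E (D * r) n ⟩
    E * (suc (D * r) * n)                       ≤⟨ *-monoʳ-≤ E (*-monoˡ-≤ n ratio) ⟩
    E * (M * p * n)                             ∎)
    where
    open ≤-Reasoning
    X = D * E + M
    regroup₁ : ∀ e M p n → e * (M * p * n) ≡ M * e * (p * n)
    regroup₁ = solve-∀
    regroup₂ : ∀ M e r t → M * e * (r * t) ≡ r * (M * (e * t))
    regroup₂ = solve-∀
    regroup₃ : ∀ r M w Q X → r * (M * (suc w * (Q * X))) ≡ r * ((M * Q + w * (M * Q)) * X)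
    regroup₃ = solve-∀
    regroup₄ : ∀ r L n D e M → r * ((L + n) * (D * e + M)) ≡ e * (D * r * n) + r * M * n + r * (L * (D * e + M))
    regroup₄ = solve-∀
    regroup₅ : ∀ e a n d → e * (a * n) + d * n + n ≡ e * (a * n) + suc d * n
    regroup₅ = solve-∀
    regroup₆ : ∀ e a n → e * (a * n) + e * n ≡ e * (suc a * n)
    regroup₆ = solve-∀

  -- Losses of n²D come from rounding n/L down and from q/(q − 1), one of n²Dp from the ratio M/D.
  purple-density : ∀ p r h M D n w L Q v y → L ≡ M * Q → 0 < D → D ≤ M → p ≤ r →
    M * p * h ≤ D * r * h + D * p → w * L ≤ n → n ≤ w * L + L → h * L ≤ n →
    Q * h ≤ h * v + Q → n * (w * (D * v)) ≤ y →
    p * (n * n) * h ≤ r * h * y + 3 * r * (n * n)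
  purple-density p r h M D n w L Q v y refl D>0 D≤M p≤r ratio-near wL≤n n≤wL+L hL≤n v-large y-large =
    *-cancelˡ-≤ M {{>-nonZero (≤-trans D>0 D≤M)}} (begin
      M * (p * (n * n) * h)                     ≡⟨ regroup₁ M p (n * n) h ⟩
      n * n * (M * p * h)                       ≤⟨ *-monoʳ-≤ (n * n) ratio-near ⟩
      n * n * (D * r * h + D * p)               ≡⟨ regroup₂ (n * n) D r h p ⟩
      r * (n * n * D * h) + n * n * D * p       ≤⟨ +-mono-≤ (*-monoʳ-≤ r degrees) (*-mono-≤ (*-monoʳ-≤ (n * n) D≤M) p≤r) ⟩
      r * (M * h * y + (n * n * D + n * n * D)) + n * n * M * r
        ≤⟨ +-monoˡ-≤ (n * n * M * r) (*-monoʳ-≤ r (+-monoʳ-≤ (M * h * y) (+-mono-≤ (*-monoʳ-≤ (n * n) D≤M) (*-monoʳ-≤ (n * n) D≤M)))) ⟩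
      r * (M * h * y + (n * n * M + n * n * M)) + n * n * M * r
        ≡⟨ regroup₃ r M h y (n * n) ⟩
      M * (r * h * y + 3 * r * (n * n))         ∎)
    where
    open ≤-Reasoning
    regroup₁ : ∀ M p s h → M * (p * s * h) ≡ s * (M * p * h)
    regroup₁ = solve-∀
    regroup₂ : ∀ s D r h p → s * (D * r * h + D * p) ≡ r * (s * D * h) + s * D * p
    regroup₂ = solve-∀
    regroup₃ : ∀ r M h y s → r * (M * h * y + (s * M + s * M)) + s * M * r ≡ M * (r * h * y + 3 * r * s)
    regroup₃ = solve-∀
    degrees : n * n * D * h ≤ M * h * y + (n * n * D + n * n * D)
    degrees = begin
      n * n * D * h                                        ≤⟨ *-monoˡ-≤ h (*-monoˡ-≤ D (*-monoʳ-≤ n n≤wL+L)) ⟩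
      n * (w * L + L) * D * h                              ≡⟨ expand₁ n w L D h ⟩
      n * (w * L) * D * h + n * (h * L) * D                ≤⟨ +-monoʳ-≤ (n * (w * L) * D * h) (*-monoˡ-≤ D (*-monoʳ-≤ n hL≤n)) ⟩
      n * (w * L) * D * h + n * n * D                      ≡⟨ expand₂ n w M Q D h ⟩
      n * w * M * D * (Q * h) + n * n * D                  ≤⟨ +-monoˡ-≤ (n * n * D) (*-monoʳ-≤ (n * w * M * D) v-large) ⟩
      n * w * M * D * (h * v + Q) + n * n * D              ≡⟨ expand₃ n w M D h v Q ⟩
      M * h * (n * (w * (D * v))) + (n * (w * L) * D + n * n * D)
        ≤⟨ +-mono-≤ (*-monoʳ-≤ (M * h) y-large) (+-monoˡ-≤ (n * n * D) (*-monoˡ-≤ D (*-monoʳ-≤ n wL≤n))) ⟩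
      M * h * y + (n * n * D + n * n * D)                  ∎
      where
      expand₁ : ∀ n w L D h → n * (w * L + L) * D * h ≡ n * (w * L) * D * h + n * (h * L) * D
      expand₁ = solve-∀
      expand₂ : ∀ n w M Q D h → n * (w * (M * Q)) * D * h + n * n * D ≡ n * w * M * D * (Q * h) + n * n * D
      expand₂ = solve-∀
      expand₃ : ∀ n w M D h v Q → n * w * M * D * (h * v + Q) + n * n * D ≡ M * h * (n * (w * (D * v))) + (n * (w * (M * Q)) * D + n * n * D)
      expand₃ = solve-∀

  module Density (p r h : ℕ) (3p≤r : 3 * p ≤ r) (h>0 : 0 < h) (G : Balanced)
    (ratio-above : Balanced.D G * r < Balanced.M G * p)
    (ratio-near : Balanced.M G * p * h ≤ Balanced.D G * r * h + Balanced.D G * p) where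
    open Balanced G using (M; D; D>0; D≤M)

    private
      -- `n<2^n` then gives r·M < 2ᵈ, the size of 2ᵈ that `too-large-clique` demands.
      d = r * M
      q = suc d * h

      q>0 : 0 < q
      q>0 = *-mono-≤ (s≤s (z≤n {d})) h>0

      open BlowUp G q d q>0 using (L; L-nonZero; Q; χ; triangle-free-χ; clique-bound; purple-bound; length-ws)

      -- The first summand makes rounding n / L down cost at most a fraction 1/h; the second makes n
      -- outweigh the rounding up in `too-large-clique`.
      N = h * L + suc (r * (L * (D * 2 ^ d + M)))

      n≤ : ∀ n → n ≤ n / L * L + L
      n≤ n = ≤-trans (≤-reflexive (m≡m%n+[m/n]*n n L)) (≤-trans (+-monoˡ-≤ _ (<⇒≤ (m%n<n n L))) (≤-reflexive (+-comm L _)))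

      no-large-clique : ∀ n → N ≤ n → ∀ t → p * n ≤ r * t → KFree BlueOrPurple (χ n) t
      no-large-clique n N≤n t pn≤rt clique =
        too-large-clique p r M D n (n / L) L Q (2 ^ d) t length-ws (m/n*n≤m n L) ratio-above
          (≤-trans (m≤n+m _ (h * L)) N≤n) (n<2^n d) pn≤rt (clique-bound n t clique)

      many-purple : ∀ n → N ≤ n → p * (n * n) * h ≤ r * h * (2 * purpleCount (χ n)) + 3 * r * (n * n)
      many-purple n N≤n =
        purple-density p r h M D n (n / L) L Q (pred q ^ d) (2 * purpleCount (χ n)) length-ws D>0 D≤M
          (≤-trans (m≤n*m p 3) 3p≤r) ratio-near (m/n*n≤m n L) (n≤ n) (≤-trans (m≤m+n (h * L) _) N≤n)
          (bernoulli-h h d h>0) (purple-bound n)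

    result : Σ ℕ λ N → ∀ n → N ≤ n → Σ (Colouring n) λ χ →
      KFree RedOrPurple χ 3 × (∀ t → p * n ≤ r * t → KFree BlueOrPurple χ t) ×
      p * (n * n) * h ≤ r * h * (2 * purpleCount χ) + 3 * r * (n * n)
    result = N , λ n N≤n → χ n , triangle-free-χ n , no-large-clique n N≤n , many-purple n N≤n

  -- The integer form of the theorem for c = p/r: the condition on t says t ≥ cn, which keeps
  -- rational ceilings out of the construction, and the last inequality says 2P/n² ≥ c - 3/h for the
  -- number P of purple edges.
  colourings : ∀ p r h → 0 < p → 3 * p ≤ r → 0 < h → Σ ℕ λ N → ∀ n → N ≤ n → Σ (Colouring n) λ χ →
    KFree RedOrPurple χ 3 × (∀ t → p * n ≤ r * t → KFree BlueOrPurple χ t) ×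
    p * (n * n) * h ≤ r * h * (2 * purpleCount χ) + 3 * r * (n * n)
  colourings p r h p>0 3p≤r h>0 = from-balanced (Approximation.balanced-near p r h p>0 3p≤r)
    where
    from-balanced : (Σ Balanced λ G → let open Balanced G in D * r < M * p × M * p * h ≤ D * r * h + D * p) → _
    from-balanced (G , above , near) = Density.result p r h 3p≤r h>0 G above near

open import Data.Nat using (ℕ) renaming (_≤_ to _≤ℕ_)
open import Data.Rational using (ℚ; 0ℚ; _<_; _≤_; _*_; _-_; _/_; ½)
open import Data.Integer using (+_)
open import Data.Product using (Σ)
import Data.Nat as ℕ
open import Data.Nat.Coprimality using (Coprime)
import Data.Nat.Properties as ℕₚ
import Data.Nat.Tactic.RingSolver as ℕ-Solver
import Data.Integer as ℤ
import Data.Integer.DivMod as ℤ-DivMod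
import Data.Integer.Properties as ℤₚ
import Data.Integer.Tactic.RingSolver as ℤ-Solver
open import Data.Integer using (+[1+_]; -[1+_]; ∣_∣)
open import Data.Product using (_×_; _,_)
open import Data.Rational using (mkℚ; toℚᵘ; ↥_; ↧_; floor; ceiling)
import Data.Rational as ℚ
import Data.Rational.Properties as ℚₚ
open import Data.Rational.Unnormalised using (mkℚᵘ; *≤*)
import Data.Rational.Unnormalised as ℚᵘ
import Data.Rational.Unnormalised.Properties as ℚᵘₚ
open import Relation.Binary.PropositionalEquality
open Construction using (colourings)

-- Rational arithmetic

toℚᵘ-ℕtoℚ : ∀ m → toℚᵘ (ℕtoℚ m) ℚᵘ.≃ mkℚᵘ (+ m) 0
toℚᵘ-ℕtoℚ m = ℚₚ.toℚᵘ-fromℚᵘ (mkℚᵘ (+ m) 0)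

cross-multiply : ∀ z {w} → toℚᵘ z ℚᵘ.≃ w → ↥ z ℤ.* ℚᵘ.↧ w ≡ ℚᵘ.↥ w ℤ.* ↧ z
cross-multiply record{} = ℚᵘₚ.drop-*≡*

floor*↧≤↥ : ∀ z → floor z ℤ.* ↧ z ℤ.≤ ↥ z
floor*↧≤↥ z@record{} = ℤ-DivMod.[n/d]*d≤n (↥ z) (↧ z)

↥≤ceiling*↧ : ∀ z → ↥ z ℤ.≤ ceiling z ℤ.* ↧ z
↥≤ceiling*↧ z@record{} = begin
  ↥ z                                ≡⟨ ℤₚ.neg-involutive (↥ z) ⟨
  ℤ.- (ℤ.- ↥ z)                      ≡⟨ cong ℤ.-_ (ℚₚ.↥-neg z) ⟨
  ℤ.- (↥ (ℚ.- z))                    ≤⟨ ℤₚ.neg-mono-≤ (floor*↧≤↥ (ℚ.- z)) ⟩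
  ℤ.- (floor (ℚ.- z) ℤ.* ↧ (ℚ.- z))  ≡⟨ ℤₚ.neg-distribˡ-* (floor (ℚ.- z)) (↧ (ℚ.- z)) ⟩
  ceiling z ℤ.* ↧ (ℚ.- z)            ≡⟨ cong (ceiling z ℤ.*_) (ℚₚ.↧-neg z) ⟩
  ceiling z ℤ.* ↧ z                  ∎
  where open ℤₚ.≤-Reasoning

i≤∣i∣ : ∀ i → i ℤ.≤ + ∣ i ∣
i≤∣i∣ (+ n)    = ℤₚ.≤-refl
i≤∣i∣ -[1+ n ] = ℤ.-≤+

-- The ceiling dominates the product, and the absolute value in `ceilℕ` can only enlarge it. The
-- reduced fraction z is compared with p·n/r by cross-multiplication, so its denominator cancels at
-- the end.
ceilℕ-bound : ∀ p r-1 .(coprime : Coprime p (ℕ.suc r-1)) n → p ℕ.* n ℕ.≤ ℕ.suc r-1 ℕ.* ceilℕ (mkℚ (+ p) r-1 coprime * ℕtoℚ n)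
ceilℕ-bound p r-1 coprime n = ℤₚ.drop‿+≤+ (ℤₚ.*-cancelʳ-≤-pos (+ (p ℕ.* n)) (+ (r ℕ.* ceilℕ z)) (↧ z) (begin
  + (p ℕ.* n) ℤ.* ↧ z                     ≡⟨ cong (ℤ._* ↧ z) (ℤₚ.pos-* p n) ⟩
  + p ℤ.* + n ℤ.* ↧ z                     ≡⟨ z≃ ⟨
  ↥ z ℤ.* + (r ℕ.* 1)                     ≡⟨ cong (λ k → ↥ z ℤ.* + k) (ℕₚ.*-identityʳ r) ⟩
  ↥ z ℤ.* + r                             ≤⟨ ℤₚ.*-monoʳ-≤-nonNeg (+ r) (↥≤ceiling*↧ z) ⟩
  ceiling z ℤ.* ↧ z ℤ.* + r               ≤⟨ ℤₚ.*-monoʳ-≤-nonNeg (+ r) (ℤₚ.*-monoʳ-≤-nonNeg (↧ z) (i≤∣i∣ (ceiling z))) ⟩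
  + ceilℕ z ℤ.* ↧ z ℤ.* + r               ≡⟨ rearrange (+ ceilℕ z) (↧ z) (+ r) ⟩
  + r ℤ.* + ceilℕ z ℤ.* ↧ z               ≡⟨ cong (ℤ._* ↧ z) (ℤₚ.pos-* r (ceilℕ z)) ⟨
  + (r ℕ.* ceilℕ z) ℤ.* ↧ z               ∎))
  where
  open ℤₚ.≤-Reasoning
  r = ℕ.suc r-1
  c = mkℚ (+ p) r-1 coprime
  z = c * ℕtoℚ n
  rearrange : ∀ a b c → a ℤ.* b ℤ.* c ≡ c ℤ.* a ℤ.* b
  rearrange = ℤ-Solver.solve-∀
  z≃ : ↥ z ℤ.* + (r ℕ.* 1) ≡ + p ℤ.* + n ℤ.* ↧ z
  z≃ = cross-multiply z (ℚᵘₚ.≃-trans (ℚₚ.toℚᵘ-homo-* c (ℕtoℚ n)) (ℚᵘₚ.*-congˡ {toℚᵘ c} (toℚᵘ-ℕtoℚ n)))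

-- Passing to unnormalised rationals gives the left side an explicit numerator and the denominator
-- 2·r·f, free of common-factor reductions; clearing that denominator leaves the integer hypothesis.
density-bound : ∀ p r-1 .(coprime : Coprime p (ℕ.suc r-1)) e f-1 .(coprime′ : Coprime e (ℕ.suc f-1)) n P → let r = ℕ.suc r-1; f = ℕ.suc f-1 in
  p ℕ.* (n ℕ.* n) ℕ.* f ℕ.≤ r ℕ.* f ℕ.* (2 ℕ.* P) ℕ.+ e ℕ.* r ℕ.* (n ℕ.* n) →
  (½ * (ℕtoℚ n * ℕtoℚ n)) * (mkℚ (+ p) r-1 coprime - mkℚ (+ e) f-1 coprime′) ≤ ℕtoℚ P
density-bound p r-1 coprime e f-1 coprime′ n P bound = ℚₚ.toℚᵘ-cancel-≤
  (ℚᵘₚ.≤-respˡ-≃ (ℚᵘₚ.≃-sym lhs≃) (ℚᵘₚ.≤-respʳ-≃ (ℚᵘₚ.≃-sym (toℚᵘ-ℕtoℚ P)) (*≤* cleared)))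
  where
  r = ℕ.suc r-1
  f = ℕ.suc f-1
  c = mkℚ (+ p) r-1 coprime
  ε = mkℚ (+ e) f-1 coprime′
  nᵘ = mkℚᵘ (+ n) 0
  lhsᵘ = (ℚᵘ.½ ℚᵘ.* (nᵘ ℚᵘ.* nᵘ)) ℚᵘ.* (mkℚᵘ (+ p) r-1 ℚᵘ.+ ℚᵘ.- mkℚᵘ (+ e) f-1)
  lhs≃ : toℚᵘ ((½ * (ℕtoℚ n * ℕtoℚ n)) * (c - ε)) ℚᵘ.≃ lhsᵘ
  lhs≃ = ℚᵘₚ.≃-trans (ℚₚ.toℚᵘ-homo-* (½ * (ℕtoℚ n * ℕtoℚ n)) (c - ε)) (ℚᵘₚ.*-cong
    (ℚᵘₚ.≃-trans (ℚₚ.toℚᵘ-homo-* ½ (ℕtoℚ n * ℕtoℚ n)) (ℚᵘₚ.*-congˡ {toℚᵘ ½}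
      (ℚᵘₚ.≃-trans (ℚₚ.toℚᵘ-homo-* (ℕtoℚ n) (ℕtoℚ n)) (ℚᵘₚ.*-cong (toℚᵘ-ℕtoℚ n) (toℚᵘ-ℕtoℚ n)))))
    (ℚᵘₚ.≃-trans (ℚₚ.toℚᵘ-homo-+ c (ℚ.- ε)) (ℚᵘₚ.+-congʳ (toℚᵘ c) (ℚₚ.toℚᵘ-homo‿- ε))))
  boundℤ : + p ℤ.* (+ n ℤ.* + n) ℤ.* + f ℤ.≤ + r ℤ.* + f ℤ.* (+ 2 ℤ.* + P) ℤ.+ + e ℤ.* + r ℤ.* (+ n ℤ.* + n)
  boundℤ = subst₂ ℤ._≤_ left right (ℤ.+≤+ bound)
    where
    product₃ : ∀ a b c → + (a ℕ.* b ℕ.* c) ≡ + a ℤ.* + b ℤ.* + c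
    product₃ a b c = trans (ℤₚ.pos-* (a ℕ.* b) c) (cong (ℤ._* + c) (ℤₚ.pos-* a b))
    left : + (p ℕ.* (n ℕ.* n) ℕ.* f) ≡ + p ℤ.* (+ n ℤ.* + n) ℤ.* + f
    left = trans (product₃ p (n ℕ.* n) f) (cong (λ s → + p ℤ.* s ℤ.* + f) (ℤₚ.pos-* n n))
    right : + (r ℕ.* f ℕ.* (2 ℕ.* P) ℕ.+ e ℕ.* r ℕ.* (n ℕ.* n)) ≡ + r ℤ.* + f ℤ.* (+ 2 ℤ.* + P) ℤ.+ + e ℤ.* + r ℤ.* (+ n ℤ.* + n)
    right = cong₂ ℤ._+_ (trans (product₃ r f (2 ℕ.* P)) (cong (+ r ℤ.* + f ℤ.*_) (ℤₚ.pos-* 2 P)))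
                        (trans (product₃ e r (n ℕ.* n)) (cong (+ e ℤ.* + r ℤ.*_) (ℤₚ.pos-* n n)))
  cleared : ℚᵘ.↥ lhsᵘ ℤ.* + 1 ℤ.≤ + P ℤ.* ℚᵘ.↧ lhsᵘ
  cleared = begin
    ℚᵘ.↥ lhsᵘ ℤ.* + 1                                           ≡⟨ numerator (+ p) (+ n) (+ f) (+ e) (+ r) ⟩
    + p ℤ.* (+ n ℤ.* + n) ℤ.* + f ℤ.- + e ℤ.* + r ℤ.* (+ n ℤ.* + n)  ≤⟨ ℤₚ.+-monoˡ-≤ (ℤ.- (+ e ℤ.* + r ℤ.* (+ n ℤ.* + n))) boundℤ ⟩
    + r ℤ.* + f ℤ.* (+ 2 ℤ.* + P) ℤ.+ + e ℤ.* + r ℤ.* (+ n ℤ.* + n) ℤ.- + e ℤ.* + r ℤ.* (+ n ℤ.* + n)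
                                                                ≡⟨ denominator (+ r) (+ f) (+ P) (+ e ℤ.* + r ℤ.* (+ n ℤ.* + n)) ⟩
    + P ℤ.* (+ 2 ℤ.* (+ r ℤ.* + f))                             ≡⟨ cong (λ k → + P ℤ.* (+ 2 ℤ.* k)) (ℤₚ.pos-* r f) ⟨
    + P ℤ.* (+ 2 ℤ.* + (r ℕ.* f))                               ≡⟨ cong (+ P ℤ.*_) (ℤₚ.pos-* 2 (r ℕ.* f)) ⟨
    + P ℤ.* + (2 ℕ.* (r ℕ.* f))                                 ∎
    where
    open ℤₚ.≤-Reasoning
    numerator : ∀ p n f e r → (+ 1 ℤ.* (n ℤ.* n)) ℤ.* (p ℤ.* f ℤ.+ (ℤ.- e) ℤ.* r) ℤ.* + 1 ≡ p ℤ.* (n ℤ.* n) ℤ.* f ℤ.- e ℤ.* r ℤ.* (n ℤ.* n)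
    numerator = ℤ-Solver.solve-∀
    denominator : ∀ r f P x → r ℤ.* f ℤ.* (+ 2 ℤ.* P) ℤ.+ x ℤ.- x ≡ P ℤ.* (+ 2 ℤ.* (r ℤ.* f))
    denominator = ℤ-Solver.solve-∀

theorem3p1 : (c : ℚ) → 0ℚ < c → c ≤ (+ 1) / 3 →
    (ε : ℚ) → 0ℚ < ε →
    Σ ℕ λ N → (n : ℕ) → N ≤ℕ n →
    gAtLeast n 3 (ceilℕ (c * ℕtoℚ n)) ((½ * (ℕtoℚ n * ℕtoℚ n)) * (c - ε))
theorem3p1 (mkℚ (+ 0) _ _) (ℚ.*<* (ℤ.+<+ ())) _ _ _
theorem3p1 (mkℚ (+[1+ _ ]) _ _) _ _ (mkℚ (+ 0) _ _) (ℚ.*<* (ℤ.+<+ ()))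
theorem3p1 c@(mkℚ (+[1+ p-1 ]) r-1 cop) _ c≤⅓ ε@(mkℚ (+[1+ e-1 ]) f-1 cop′) _
  -- The total error 3/h becomes 1/f for h = 3f, and 1/f ≤ e/f = ε because the numerator e is at
  -- least 1.
  = assemble (colourings p r (3 ℕ.* f) (ℕ.s≤s ℕ.z≤n) 3p≤r (ℕ.s≤s ℕ.z≤n))
  where
  p = ℕ.suc p-1
  r = ℕ.suc r-1
  f = ℕ.suc f-1
  e = ℕ.suc e-1
  3p≤r : 3 ℕ.* p ℕ.≤ r
  3p≤r = subst₂ ℕ._≤_ (ℕₚ.*-comm p 3) (ℕₚ.*-identityˡ r) (ℤₚ.drop‿+≤+ (ℚₚ.drop-*≤* c≤⅓))
  Good : ∀ n → Colouring n → Set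
  Good n χ = KFree RedOrPurple χ 3 × (∀ t → p ℕ.* n ℕ.≤ r ℕ.* t → KFree BlueOrPurple χ t) ×
    p ℕ.* (n ℕ.* n) ℕ.* (3 ℕ.* f) ℕ.≤ r ℕ.* (3 ℕ.* f) ℕ.* (2 ℕ.* purpleCount χ) ℕ.+ 3 ℕ.* r ℕ.* (n ℕ.* n)
  finish : ∀ n → Σ (Colouring n) (Good n) →
    gAtLeast n 3 (ceilℕ (c * ℕtoℚ n)) ((½ * (ℕtoℚ n * ℕtoℚ n)) * (c - ε))
  finish n (χ , noK₃ , noK , many) = χ , noK₃ , noK (ceilℕ (c * ℕtoℚ n)) (ceilℕ-bound p r-1 cop n) ,
    density-bound p r-1 cop e f-1 cop′ n P (ℕₚ.≤-trans (ℕₚ.*-cancelˡ-≤ 3 thrice)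
      (ℕₚ.+-monoʳ-≤ (r ℕ.* f ℕ.* (2 ℕ.* P)) (ℕₚ.*-monoˡ-≤ (n ℕ.* n) (ℕₚ.m≤n*m r e))))
    where
    open ℕₚ.≤-Reasoning
    P = purpleCount χ
    regroup₁ : ∀ p s f → 3 ℕ.* (p ℕ.* s ℕ.* f) ≡ p ℕ.* s ℕ.* (3 ℕ.* f)
    regroup₁ = ℕ-Solver.solve-∀
    regroup₂ : ∀ r f P s → r ℕ.* (3 ℕ.* f) ℕ.* (2 ℕ.* P) ℕ.+ 3 ℕ.* r ℕ.* s ≡ 3 ℕ.* (r ℕ.* f ℕ.* (2 ℕ.* P) ℕ.+ r ℕ.* s)
    regroup₂ = ℕ-Solver.solve-∀
    thrice : 3 ℕ.* (p ℕ.* (n ℕ.* n) ℕ.* f) ℕ.≤ 3 ℕ.* (r ℕ.* f ℕ.* (2 ℕ.* P) ℕ.+ r ℕ.* (n ℕ.* n))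
    thrice = begin
      3 ℕ.* (p ℕ.* (n ℕ.* n) ℕ.* f)                                       ≡⟨ regroup₁ p (n ℕ.* n) f ⟩
      p ℕ.* (n ℕ.* n) ℕ.* (3 ℕ.* f)                                       ≤⟨ many ⟩
      r ℕ.* (3 ℕ.* f) ℕ.* (2 ℕ.* P) ℕ.+ 3 ℕ.* r ℕ.* (n ℕ.* n)             ≡⟨ regroup₂ r f P (n ℕ.* n) ⟩
      3 ℕ.* (r ℕ.* f ℕ.* (2 ℕ.* P) ℕ.+ r ℕ.* (n ℕ.* n))                   ∎
  assemble : (Σ ℕ λ N → ∀ n → N ≤ℕ n → Σ (Colouring n) (Good n)) →
    Σ ℕ λ N → (n : ℕ) → N ≤ℕ n → gAtLeast n 3 (ceilℕ (c * ℕtoℚ n)) ((½ * (ℕtoℚ n * ℕtoℚ n)) * (c - ε))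
  assemble (N , build) = N , λ n N≤n → finish n (build n N≤n)
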